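{- Let $H$ be a fixed, connected graph. Then Induced Graph Matching on fuzzy circular-arc graphs $G$ can be solved in polynomial time; that is, there is a polynomial-time algorithm (with polynomial depending on $H$) that, given a fuzzy circular-arc graph $G$ and $k\in\mathbb N$, decides whether $G$ has an induced $H$-matching of size $k$.
   Context: All graphs are finite, simple and undirected. Consider a family of arcs on a circle (arcs are not single points), one arc per vertex. The family is almost proper if any two arcs either have the same endpoints and cover the same part of the circle, or neither is a subset of the other. It is almost strict if, for any maximal set of arcs with the same endpoints, at most one of these endpoints is also an endpoint of an arc outside the set. A graph is a fuzzy intersection graph of the family if two vertices are adjacent whenever their arcs intersect in more than one point, and nonadjacent whenever their arcs are disjoint (if the arcs intersect in exactly one point, the vertices may or may not be adjacent). A graph is a fuzzy circular-arc graph if it is a fuzzy intersection graph of an almost-proper, almost-strict family of arcs on a circle. An occurrence of $H$ in $G$ is an induced subgraph of $G$ isomorphic to $H$. An induced $H$-matching of size $k$ in $G$ is a set $\{H_1,\dots,H_k\}$ of occurrences of $H$ in $G$ that are pairwise vertex-disjoint and such that no edge of $G$ joins a vertex of $H_i$ to a vertex of $H_j$ for $i\neq j$. -}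

module Defs where

open import Data.Bool.Base using (Bool; true; false; T)
open import Data.Fin.Base using (Fin; zero)
open import Data.Fin.Subset using (Subset; _∈_)
open import Data.List.Base using (List; []; _∷_; tabulate)
open import Data.Nat.Base using (ℕ; suc; _+_; _*_; _^_; _≤_; NonZero)
open import Data.Nat.Binary.Base using (ℕᵇ; zero; 2[1+_]; 1+[2_]; fromℕ)
open import Data.Product.Base using (Σ-syntax; ∃-syntax; _×_; _,_)
open import Data.Rational.Base as ℚ using (ℚ; 0ℚ; 1ℚ)
import Data.Rational.Properties as ℚ
open import Data.Sum.Base using (_⊎_; inj₁; inj₂)
open import Data.Vec.Base using (Vec; _∷_; replicate; lookup; head; _[_]≔_)
open import Function.Bundles using (_⇔_)
open import Function.Definitions using (Injective)
open import Relation.Binary.Construct.Closure.ReflexiveTransitive using (Star)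
open import Relation.Binary.Definitions using (tri<; tri≈; tri>)
open import Relation.Binary.PropositionalEquality.Core using (_≡_; _≢_; refl)
open import Relation.Nullary.Negation.Core using (¬_)
open import Relation.Nullary.Reflects using (Reflects)

------------------------------------------------------------------------
-- Graphs

record Graph (n : ℕ) : Set where
  field
    adj       : Fin n → Fin n → Bool
    symmetric : ∀ u v → adj u v ≡ adj v u
    loopless  : ∀ v → adj v v ≡ false

  Adj : Fin n → Fin n → Set
  Adj u v = T (adj u v)

open Graph public

-- The null graph is, as usual, not regarded as connected.
Connected : ∀ {m} → Graph m → Set
Connected {m} H = NonZero m × (∀ u v → Star (Adj H) u v)

-- An occurrence of H in G is identified with its vertex set S; the fields
-- are an isomorphism from H onto the subgraph of G induced by S.
record IsOccurrence {m n} (H : Graph m) (G : Graph n) (S : Subset n) : Set where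
  field
    iso       : Fin m → Fin n
    injective : Injective _≡_ _≡_ iso
    image     : ∀ v → v ∈ S ⇔ (∃[ u ] iso u ≡ v)
    preserves : ∀ u w → adj H u w ≡ adj G (iso u) (iso w)

-- For H with at least one vertex, disjointness makes the k occurrences
-- distinct, so that they form a set of size k.
record InducedMatching {m n} (H : Graph m) (G : Graph n) (k : ℕ) : Set where
  field
    member      : Fin k → Subset n
    occurrences : ∀ i → IsOccurrence H G (member i)
    disjoint    : ∀ i j → i ≢ j → ∀ v → v ∈ member i → ¬ (v ∈ member j)
    nonadjacent : ∀ i j → i ≢ j →
                  ∀ u v → u ∈ member i → v ∈ member j → ¬ Adj G u v

------------------------------------------------------------------------
-- Real numbers (two-sided, located Dedekind cuts)

record ℝ : Set₁ where
  field
    Lower           : ℚ → Set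
    Upper           : ℚ → Set
    lower-inhabited : ∃[ q ] Lower q
    upper-inhabited : ∃[ q ] Upper q
    lower-closed    : ∀ {q r} → q ℚ.< r → Lower r → Lower q
    upper-closed    : ∀ {q r} → q ℚ.< r → Upper q → Upper r
    lower-open      : ∀ {q} → Lower q → ∃[ r ] (q ℚ.< r × Lower r)
    upper-open      : ∀ {r} → Upper r → ∃[ q ] (q ℚ.< r × Upper q)
    disjoint        : ∀ q → ¬ (Lower q × Upper q)
    located         : ∀ {q r} → q ℚ.< r → Lower q ⊎ Upper r

infix 4 _<ᴿ_ _≤ᴿ_ _≈ᴿ_

_<ᴿ_ : ℝ → ℝ → Set
x <ᴿ y = ∃[ q ] (ℝ.Upper x q × ℝ.Lower y q)

_≤ᴿ_ : ℝ → ℝ → Set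
x ≤ᴿ y = ¬ (y <ᴿ x)

_≈ᴿ_ : ℝ → ℝ → Set
x ≈ᴿ y = x ≤ᴿ y × y ≤ᴿ x

fromℚ : ℚ → ℝ
fromℚ p = record
  { Lower           = ℚ._< p
  ; Upper           = p ℚ.<_
  ; lower-inhabited = p ℚ.- 1ℚ , below
  ; upper-inhabited = p ℚ.+ 1ℚ , above
  ; lower-closed    = ℚ.<-trans
  ; upper-closed    = λ q<r p<q → ℚ.<-trans p<q q<r
  ; lower-open      = λ q<p → let m , q<m , m<p = ℚ.<-dense q<p in m , q<m , m<p
  ; upper-open      = λ p<r → let m , p<m , m<r = ℚ.<-dense p<r in m , m<r , p<m
  ; disjoint        = λ { q (q<p , p<q) → ℚ.<-asym q<p p<q }
  ; located         = split
  }
  where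
  open import Relation.Binary.PropositionalEquality using (subst)

  below : p ℚ.- 1ℚ ℚ.< p
  below = subst (p ℚ.- 1ℚ ℚ.<_) (ℚ.+-identityʳ p)
            (ℚ.+-monoʳ-< p (ℚ.negative⁻¹ (ℚ.- 1ℚ)))

  above : p ℚ.< p ℚ.+ 1ℚ
  above = subst (ℚ._< p ℚ.+ 1ℚ) (ℚ.+-identityʳ p)
            (ℚ.+-monoʳ-< p (ℚ.positive⁻¹ 1ℚ))

  split : ∀ {q r} → q ℚ.< r → q ℚ.< p ⊎ p ℚ.< r
  split {q} q<r with ℚ.<-cmp q p
  ... | tri< q<p _    _   = inj₁ q<p
  ... | tri≈ _   refl _   = inj₂ q<r
  ... | tri> _   _    p<q = inj₂ (ℚ.<-trans p<q q<r)

------------------------------------------------------------------------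
-- Arcs on a circle

-- The circle is ℝ/ℤ, with [0,1) as set of representatives.
record Point : Set₁ where
  field
    position : ℝ
    0≤       : fromℚ 0ℚ ≤ᴿ position
    <1       : position <ᴿ fromℚ 1ℚ

open Point public using (position)

infix 4 _≈_ _<_ _≼_

_≈_ _<_ _≼_ : Point → Point → Set
p ≈ q = position p ≈ᴿ position q
p < q = position p <ᴿ position q
p ≼ q = position p ≤ᴿ position q

-- The closed arc traversed from start to end in the direction of
-- increasing position, passing through 0 when end < start.  The pairs
-- (a , b) and (b , a) therefore denote complementary arcs with the same
-- endpoints.
record Arc : Set₁ where
  field
    start    : Point
    end      : Point
    distinct : ¬ (start ≈ end)

open Arc public

infix 4 _∈ᴬ_ _⊆ᴬ_

_∈ᴬ_ : Point → Arc → Set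
p ∈ᴬ a = (start a < end a × (start a ≼ p × p ≼ end a))
       ⊎ (end a < start a × (start a ≼ p ⊎ p ≼ end a))

_⊆ᴬ_ : Arc → Arc → Set₁
a ⊆ᴬ b = ∀ p → p ∈ᴬ a → p ∈ᴬ b

IsEndpoint : Point → Arc → Set
IsEndpoint p a = p ≈ start a ⊎ p ≈ end a

SameEndpoints : Arc → Arc → Set₁
SameEndpoints a b = ∀ p → IsEndpoint p a ⇔ IsEndpoint p b

SamePart : Arc → Arc → Set₁
SamePart a b = a ⊆ᴬ b × b ⊆ᴬ a

Disjoint : Arc → Arc → Set₁
Disjoint a b = ∀ p → ¬ (p ∈ᴬ a × p ∈ᴬ b)

MeetInMoreThanOnePoint : Arc → Arc → Set₁
MeetInMoreThanOnePoint a b =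
  ∃[ p ] ∃[ q ] (¬ (p ≈ q) × (p ∈ᴬ a × p ∈ᴬ b) × (q ∈ᴬ a × q ∈ᴬ b))

Family : ℕ → Set₁
Family n = Fin n → Arc

AlmostProper : ∀ {n} → Family n → Set₁
AlmostProper arc = ∀ i j →
    (SameEndpoints (arc i) (arc j) × SamePart (arc i) (arc j))
  ⊎ (¬ (arc i ⊆ᴬ arc j) × ¬ (arc j ⊆ᴬ arc i))

-- The maximal sets of arcs with the same endpoints are the classes
-- { j | SameEndpoints (arc j) (arc i) }.  Any two endpoints p, q of the
-- class of i that are also endpoints of arcs j, k outside it must coincide.
AlmostStrict : ∀ {n} → Family n → Set₁
AlmostStrict arc = ∀ i p q → IsEndpoint p (arc i) → IsEndpoint q (arc i) →
  ∀ j k → ¬ SameEndpoints (arc j) (arc i) → IsEndpoint p (arc j) →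
          ¬ SameEndpoints (arc k) (arc i) → IsEndpoint q (arc k) →
  p ≈ q

IsFuzzyIntersectionGraph : ∀ {n} → Graph n → Family n → Set₁
IsFuzzyIntersectionGraph G arc = ∀ u v → u ≢ v →
    (MeetInMoreThanOnePoint (arc u) (arc v) → Adj G u v)
  × (Disjoint (arc u) (arc v) → ¬ Adj G u v)

IsFuzzyCircularArcGraph : ∀ {n} → Graph n → Set₁
IsFuzzyCircularArcGraph {n} G =
  Σ[ arc ∈ Family n ] (AlmostProper arc × AlmostStrict arc ×
                       IsFuzzyIntersectionGraph G arc)

------------------------------------------------------------------------
-- Polynomial time

-- The model of computation is Jones' WHILE language on binary trees, with
-- his time measure: each evaluation of a variable, constant, constructor,
-- destructor, assignment or loop test costs one unit.  Since trees can be
-- stored with sharing, and only nil can be tested for, each unit is a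
-- constant number of pointer operations; a set of trees is decidable in
-- polynomial time in this model iff it is so by a Turing machine.

infixr 5 _∙_

data Tree : Set where
  nil : Tree
  _∙_ : Tree → Tree → Tree

size : Tree → ℕ
size nil     = 1
size (s ∙ t) = suc (size s + size t)

hdᵀ tlᵀ : Tree → Tree
hdᵀ nil     = nil
hdᵀ (s ∙ t) = s
tlᵀ nil     = nil
tlᵀ (s ∙ t) = t

data Expr (r : ℕ) : Set where
  var   : Fin r → Expr r
  nil   : Expr r
  cons  : Expr r → Expr r → Expr r
  hd tl : Expr r → Expr r

Store : ℕ → Set
Store = Vec Tree

eval : ∀ {r} → Expr r → Store r → Tree
eval (var x)    σ = lookup σ x
eval nil        σ = nil
eval (cons e f) σ = eval e σ ∙ eval f σ
eval (hd e)     σ = hdᵀ (eval e σ)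
eval (tl e)     σ = tlᵀ (eval e σ)

cost : ∀ {r} → Expr r → ℕ
cost (var x)    = 1
cost nil        = 1
cost (cons e f) = suc (cost e + cost f)
cost (hd e)     = suc (cost e)
cost (tl e)     = suc (cost e)

infix  6 _:=_
infixr 5 _⨾_

data Command (r : ℕ) : Set where
  _:=_     : Fin r → Expr r → Command r
  _⨾_      : Command r → Command r → Command r
  while_run_ : Expr r → Command r → Command r

-- ⟨ C , σ ⟩⇓ τ steps t : running C from store σ ends in store τ after time t.
-- A loop is repeated as long as its test evaluates to something but nil.
infix 4 ⟨_,_⟩⇓_steps_

data ⟨_,_⟩⇓_steps_ {r : ℕ} : Command r → Store r → Store r → ℕ → Set where
  assign : ∀ {x e σ} →
           ⟨ x := e , σ ⟩⇓ (σ [ x ]≔ eval e σ) steps suc (cost e)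
  seq    : ∀ {C D σ τ υ s t} →
           ⟨ C , σ ⟩⇓ τ steps s → ⟨ D , τ ⟩⇓ υ steps t →
           ⟨ C ⨾ D , σ ⟩⇓ υ steps (s + t)
  stop   : ∀ {e C σ} → eval e σ ≡ nil →
           ⟨ while e run C , σ ⟩⇓ σ steps suc (cost e)
  loop   : ∀ {e C σ τ υ s t} → eval e σ ≢ nil →
           ⟨ C , σ ⟩⇓ τ steps s → ⟨ while e run C , τ ⟩⇓ υ steps t →
           ⟨ while e run C , σ ⟩⇓ υ steps (suc (cost e) + s + t)

-- Input and output are passed in variable zero; the others start as nil.
record Program : Set where
  field
    others : ℕ
    body   : Command (suc others)

encodeBool : Bool → Tree
encodeBool false = nil
encodeBool true  = nil ∙ nil

encodeList : List Tree → Tree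
encodeList []       = nil
encodeList (t ∷ ts) = t ∙ encodeList ts

Outputs : Program → Tree → Bool → ℕ → Set
Outputs P input b t =
  ∃[ τ ] (⟨ body , input ∷ replicate others nil ⟩⇓ τ steps t
          × head τ ≡ encodeBool b)
  where open Program P

-- Binary notation (ℕᵇ is bijective base 2), least significant digit first.
encodeℕᵇ : ℕᵇ → Tree
encodeℕᵇ zero     = nil
encodeℕᵇ 2[1+ x ] = encodeBool false ∙ encodeℕᵇ x
encodeℕᵇ 1+[2 x ] = encodeBool true  ∙ encodeℕᵇ x

encodeGraph : ∀ {n} → Graph n → Tree
encodeGraph G =
  encodeList (tabulate λ u → encodeList (tabulate λ v → encodeBool (adj G u v)))

encode : ∀ {n} → Graph n → ℕ → Tree
encode G k = encodeGraph G ∙ encodeℕᵇ (fromℕ k)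

-- One program, and one polynomial c · s ^ d in the input size s ≥ 1, for
-- all inputs; nothing is required of graphs outside the class 𝒢.
InducedMatchingInPolynomialTimeOn :
  (∀ {n} → Graph n → Set₁) → ∀ {m} → Graph m → Set₁
InducedMatchingInPolynomialTimeOn 𝒢 H =
  Σ[ P ∈ Program ] ∃[ c ] ∃[ d ]
    (∀ {n} (G : Graph n) (k : ℕ) → 𝒢 G →
      ∃[ b ] ∃[ t ] (Outputs P (encode G k) b t
                     × t ≤ c * size (encode G k) ^ d
                     × Reflects (InducedMatching H G k) b))

{-# OPTIONS --safe #-}

-- Any two members of an induced matching are apart, so the question is for an
-- independent set in the conflict graph, whose vertices are the polynomially
-- many embeddings of H into G.  Cut the circle at a member s of the matching.
-- The embeddings compatible with s then lie on a line: since H is connected,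
-- the cyclic order of the first arcs of s, x and y orients every pair (x , y)
-- without conflict, and this orientation is transitive.  Independent sets
-- are therefore chains of it.
--
-- No arcs are given, but some transitive orientation can be found without
-- them.  If y and y′ are in conflict and x is in conflict with neither, then
-- the orientations of (x , y) and (x , y′) determine each other.  Going
-- through the pairs in lexicographic order and orienting with each pair that
-- is still undecided the whole class that it determines gives a transitive
-- orientation (Hell and Huang).  All that has to be known about the arcs is
-- that no class contains both (x , y) and (y , x).  The longest chain is then
-- found layer by layer.
--
-- The points of the circle cannot be compared constructively, but only a
-- contradiction has to be derived from them, so that they can be compared
-- under a double negation.

module Submission where

open import Defs
open import Data.Bool.Base using (Bool; true; false; if_then_else_; not; _∧_; _∨_; T)
open import Data.Bool.ListAction using (any; all)
open import Data.Bool.Properties using (T-∧; T-∨; T-≡; T?)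
open import Data.Empty using (⊥; ⊥-elim)
open import Data.Fin.Base using (Fin; zero; suc; toℕ; inject≤)
open import Data.Fin.Patterns
open import Data.Fin.Properties using (toℕ-injective; injective⇒≤; inject≤-injective)
  renaming (_≟_ to _≟ᶠ_)
open import Data.Fin.Subset using (Subset) renaming (_∈_ to _∈ˢ_)
open import Data.List.Base as List
  using (List; []; _∷_; [_]; _++_; foldl; foldr; length; map; reverse; filterᵇ; concatMap; allFin; tabulate)
open import Data.List.Membership.Propositional using (_∈_; _∉_; find; lose)
open import Data.List.Membership.Propositional.Properties
  using (∈-filter⁺; ∈-filter⁻; ∈-concatMap⁺; ∈-concatMap⁻; ∈-++⁺ˡ; ∈-++⁺ʳ; ∈-++⁻; ∈-allFin; ∈-lookup)
open import Data.List.Properties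
  using ( ++-identityʳ; ++-assoc; ∷-injective; reverse-foldl; foldr-++; length-filter; length-map
        ; length-tabulate; map-tabulate; tabulate-cong)
open import Data.List.Relation.Unary.All as All using (All; []; _∷_)
import Data.List.Relation.Unary.All.Properties as All
open import Data.List.Relation.Unary.AllPairs as AllPairs using (AllPairs; []; _∷_)
import Data.List.Relation.Unary.AllPairs.Properties as AllPairs
open import Data.List.Relation.Unary.Any using (here; there)
open import Data.List.Relation.Unary.Any.Properties using (any⁺; any⁻)
open import Data.Nat.Base
  using (ℕ; zero; suc; _+_; _*_; _^_; _∸_; _≤_; z≤n; s≤s; s≤s⁻¹; _≡ᵇ_; _<ᵇ_; ⌊_/2⌋; ⌈_/2⌉)
open import Data.Nat.Binary.Base as ℕᵇ using (2[1+_]; 1+[2_])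
import Data.Nat.Binary.Properties as ℕᵇ
open import Data.Nat.Properties
  using ( *-distribʳ-+; *-identityʳ; *-identityˡ; *-mono-≤; *-monoʳ-≤; *-monoˡ-≤; +-assoc; +-comm
        ; +-commutativeSemigroup; +-identityʳ; +-mono-≤; +-monoʳ-≤; +-monoˡ-≤; +-suc; 1+n≰n; <ᵇ⇒<; <⇒<ᵇ
        ; <⇒≤; [m*n]*[o*p]≡[m*o]*[n*p]; ^-distribˡ-+-*; ^-monoʳ-≤; m≤m+n; m≤n+m; m≤n⇒m<n∨m≡n; m≤n⇒m≤1+n
        ; m≤n⇒m≤n+o; m≤n⇒m≤o+n; n∸n≡0; n≤1+n; ∸-+-assoc; ≡ᵇ⇒≡; ≡⇒≡ᵇ; ≤-refl; ≤-reflexive; ≤-trans; ≰⇒>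
        ; ⌊n/2⌋≤n; _≤?_; module ≤-Reasoning)
open import Data.Nat.Tactic.RingSolver using (solve-∀)
open import Data.Product.Base using (Σ-syntax; ∃-syntax; _×_; _,_; proj₁; proj₂; swap)
import Data.Rational.Base as ℚ
import Data.Rational.Properties as ℚ
open import Data.Sum.Base using (_⊎_; inj₁; inj₂; [_,_]′)
open import Data.Vec.Base as Vec using (Vec; []; _∷_; lookup)
open import Data.Vec.Properties
  using (lookup∘tabulate; tabulate∘lookup; lookup⇒[]=; []=⇒lookup)
  renaming (tabulate-cong to Vec-tabulate-cong)
open import Function.Base using (_∘_; id; flip)
open import Function.Bundles using (_⇔_; Equivalence; mk⇔)
open import Relation.Binary.Construct.Closure.ReflexiveTransitive using (Star; ε; _◅_; _◅◅_; gmap)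
  renaming (reverse to reverseStar)
open import Relation.Binary.Definitions using (tri<; tri≈; tri>)
open import Relation.Binary.PropositionalEquality
  using (_≡_; _≢_; refl; sym; trans; cong; cong₂; subst)
open import Relation.Nullary using (¬_; yes; no)
open import Relation.Nullary.Reflects using (Reflects; ofʸ; ofⁿ)

-- Two points carry the proof besides the geometry. The running time is that of a concrete program,
-- so functions are assembled from combinators that carry a command together with bounds on its time
-- and on the size of its value. The obstacle is iteration, which could double the state in every
-- round. Folds therefore require that a round adds to the state at most a polynomial in the current
-- element and the context. The rounds of the algorithm comply because each one selects from a fixed
-- list, or prepends such a selection to the state. Orienting class by class guarantees only that
-- the result is closed and antisymmetric; three classes could still form a cyclic triangle. The
-- lexicographic order excludes this: each class is entered at its first vertex, and the triangle
-- lemma transports a cyclic triangle to that vertex, where it contradicts the minimality of a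
-- neighbouring class or antisymmetry. The orientation found need not be the geometric one. For
-- every transitive orientation the chains are exactly the independent sets, so the length of a
-- longest chain is the same.

-- Polynomial bounds

infixl 6 _⊕_
infixl 7 _⊗_

data Poly : Set where
  X       : Poly
  K       : ℕ → Poly
  _⊕_ _⊗_ : Poly → Poly → Poly

⟪_⟫ : Poly → ℕ → ℕ
⟪ X ⟫     s = s
⟪ K c ⟫   s = c
⟪ p ⊕ q ⟫ s = ⟪ p ⟫ s + ⟪ q ⟫ s
⟪ p ⊗ q ⟫ s = ⟪ p ⟫ s * ⟪ q ⟫ s

infixr 8 _⟨_⟩

_⟨_⟩ : Poly → Poly → Poly
X       ⟨ r ⟩ = r
K c     ⟨ r ⟩ = K c
(p ⊕ q) ⟨ r ⟩ = p ⟨ r ⟩ ⊕ q ⟨ r ⟩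
(p ⊗ q) ⟨ r ⟩ = p ⟨ r ⟩ ⊗ q ⟨ r ⟩

⟪⟫-∘ : ∀ p r s → ⟪ p ⟨ r ⟩ ⟫ s ≡ ⟪ p ⟫ (⟪ r ⟫ s)
⟪⟫-∘ X       r s = refl
⟪⟫-∘ (K c)   r s = refl
⟪⟫-∘ (p ⊕ q) r s = cong₂ _+_ (⟪⟫-∘ p r s) (⟪⟫-∘ q r s)
⟪⟫-∘ (p ⊗ q) r s = cong₂ _*_ (⟪⟫-∘ p r s) (⟪⟫-∘ q r s)

⟪⟫-mono : ∀ p {s t} → s ≤ t → ⟪ p ⟫ s ≤ ⟪ p ⟫ t
⟪⟫-mono X       s≤t = s≤t
⟪⟫-mono (K c)   s≤t = ≤-refl
⟪⟫-mono (p ⊕ q) s≤t = +-mono-≤ (⟪⟫-mono p s≤t) (⟪⟫-mono q s≤t)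
⟪⟫-mono (p ⊗ q) s≤t = *-mono-≤ (⟪⟫-mono p s≤t) (⟪⟫-mono q s≤t)

⟪⟫-subst : ∀ p r {s x} → x ≤ ⟪ r ⟫ s → ⟪ p ⟫ x ≤ ⟪ p ⟨ r ⟩ ⟫ s
⟪⟫-subst p r {s} x≤ = ≤-trans (⟪⟫-mono p x≤) (≤-reflexive (sym (⟪⟫-∘ p r s)))

-- In a sum, both exponents are raised to their sum, which is where `1 ≤ s` enters.
monomial-bound : ∀ p → ∃[ c ] ∃[ d ] ∀ s → 1 ≤ s → ⟪ p ⟫ s ≤ c * s ^ d
monomial-bound X     = 1 , 1 , λ s _ →
  ≤-reflexive (sym (trans (*-identityˡ _) (*-identityʳ s)))
monomial-bound (K c) = c , 0 , λ s _ → ≤-reflexive (sym (*-identityʳ c))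
monomial-bound (p ⊕ q)
  with c , d , p≤ ← monomial-bound p | c′ , d′ , q≤ ← monomial-bound q =
  c + c′ , d + d′ , λ where
    s@(suc _) 1≤s → begin
      ⟪ p ⟫ s + ⟪ q ⟫ s                   ≤⟨ +-mono-≤ (p≤ s 1≤s) (q≤ s 1≤s) ⟩
      c * s ^ d + c′ * s ^ d′             ≤⟨ +-mono-≤ (*-monoʳ-≤ c (^-monoʳ-≤ s (m≤m+n d d′)))
                                                      (*-monoʳ-≤ c′ (^-monoʳ-≤ s (m≤n+m d′ d))) ⟩
      c * s ^ (d + d′) + c′ * s ^ (d + d′) ≡⟨ *-distribʳ-+ (s ^ (d + d′)) c c′ ⟨
      (c + c′) * s ^ (d + d′)             ∎
  where open ≤-Reasoning
monomial-bound (p ⊗ q)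
  with c , d , p≤ ← monomial-bound p | c′ , d′ , q≤ ← monomial-bound q =
  c * c′ , d + d′ , λ s 1≤s → begin
      ⟪ p ⟫ s * ⟪ q ⟫ s             ≤⟨ *-mono-≤ (p≤ s 1≤s) (q≤ s 1≤s) ⟩
      (c * s ^ d) * (c′ * s ^ d′)   ≡⟨ [m*n]*[o*p]≡[m*o]*[n*p] c (s ^ d) c′ (s ^ d′) ⟩
      (c * c′) * (s ^ d * s ^ d′)   ≡⟨ cong ((c * c′) *_) (^-distribˡ-+-* s d d′) ⟨
      (c * c′) * s ^ (d + d′)       ∎
  where open ≤-Reasoning

-- Combinators for polynomial-time commands

size≥1 : ∀ t → 1 ≤ size t
size≥1 nil     = s≤s z≤n
size≥1 (_ ∙ _) = s≤s z≤n

size-hd : ∀ t → size (hdᵀ t) ≤ size t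
size-hd nil     = ≤-refl
size-hd (s ∙ t) = m≤n⇒m≤1+n (m≤m+n (size s) (size t))

size-tl : ∀ t → size (tlᵀ t) ≤ size t
size-tl nil     = ≤-refl
size-tl (s ∙ t) = m≤n⇒m≤1+n (m≤n+m (size t) (size s))

truthy : Tree → Bool
truthy nil     = false
truthy (_ ∙ _) = true

elems : Tree → List Tree
elems nil     = []
elems (s ∙ t) = s ∷ elems t

length-elems : ∀ t → length (elems t) ≤ size t
length-elems nil     = z≤n
length-elems (s ∙ t) = s≤s (≤-trans (length-elems t) (m≤n+m (size t) (size s)))

-- Register 0 holds the argument and then the value; register 1 is a stack,
-- which is left as it was found.
record PolyTime (f : Tree → Tree) : Set where
  no-eta-equality
  field
    command   : Command 2
    timeBound : Poly
    sizeBound : Poly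
    runs      : ∀ x s → ∃[ t ] (⟨ command , x ∷ s ∷ [] ⟩⇓ f x ∷ s ∷ [] steps t
                                × t ≤ ⟪ timeBound ⟫ (size x))
    small     : ∀ x → size (f x) ≤ ⟪ sizeBound ⟫ (size x)

open PolyTime

≗-PolyTime : ∀ {f g} → (∀ x → f x ≡ g x) → PolyTime f → PolyTime g
≗-PolyTime {f} {g} f≗g F = record
  { command   = command F
  ; timeBound = timeBound F
  ; sizeBound = sizeBound F
  ; runs      = λ x s → subst (λ y → ∃[ t ] (⟨ command F , x ∷ s ∷ [] ⟩⇓ y ∷ s ∷ [] steps t
                                × t ≤ ⟪ timeBound F ⟫ (size x))) (f≗g x) (runs F x s)
  ; small     = λ x → subst (λ y → size y ≤ ⟪ sizeBound F ⟫ (size x)) (f≗g x) (small F x)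
  }

val stack : Fin 2
val   = zero
stack = suc zero

opaque
  id-PolyTime : PolyTime id
  id-PolyTime = record
    { command   = val := var val
    ; timeBound = K 2
    ; sizeBound = X
    ; runs      = λ x s → _ , assign , ≤-refl
    ; small     = λ x → ≤-refl
    }

  nil-PolyTime : PolyTime (λ _ → nil)
  nil-PolyTime = record
    { command   = val := nil
    ; timeBound = K 2
    ; sizeBound = K 1
    ; runs      = λ x s → _ , assign , ≤-refl
    ; small     = λ x → ≤-refl
    }

  hd-PolyTime : PolyTime hdᵀ
  hd-PolyTime = record
    { command   = val := hd (var val)
    ; timeBound = K 3
    ; sizeBound = X
    ; runs      = λ x s → _ , assign , ≤-refl
    ; small     = size-hd
    }

  tl-PolyTime : PolyTime tlᵀ
  tl-PolyTime = record
    { command   = val := tl (var val)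
    ; timeBound = K 3
    ; sizeBound = X
    ; runs      = λ x s → _ , assign , ≤-refl
    ; small     = size-tl
    }

  ∘-PolyTime : ∀ {f g} → PolyTime g → PolyTime f → PolyTime (g ∘ f)
  ∘-PolyTime {f} G F = record
    { command   = command F ⨾ command G
    ; timeBound = timeBound F ⊕ timeBound G ⟨ sizeBound F ⟩
    ; sizeBound = sizeBound G ⟨ sizeBound F ⟩
    ; runs      = λ x s →
        let t , F⇓ , t≤ = runs F x s
            u , G⇓ , u≤ = runs G (f x) s
        in  t + u , seq F⇓ G⇓ ,
            +-mono-≤ t≤ (≤-trans u≤ (⟪⟫-subst (timeBound G) (sizeBound F) (small F x)))
    ; small     = λ x → ≤-trans (small G (f x)) (⟪⟫-subst (sizeBound G) (sizeBound F) (small F x))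
    }

  -- The stack keeps the argument while `F` runs, and the value of `F` while `G` runs.
  ∙-PolyTime : ∀ {f g} → PolyTime f → PolyTime g → PolyTime (λ x → f x ∙ g x)
  ∙-PolyTime {f} {g} F G = record
    { command   = stack := cons (var val) (var stack)
                ⨾ command F
                ⨾ stack := cons (var val) (var stack)
                ⨾ val := hd (tl (var stack))
                ⨾ stack := cons (hd (var stack)) (tl (tl (var stack)))
                ⨾ command G
                ⨾ val := cons (hd (var stack)) (var val)
                ⨾ stack := tl (var stack)
    ; timeBound = K 4 ⊕ (timeBound F ⊕ (K 4 ⊕ (K 4 ⊕ (K 7 ⊕ (timeBound G ⊕ (K 5 ⊕ K 3))))))
    ; sizeBound = K 1 ⊕ (sizeBound F ⊕ sizeBound G)
    ; runs      = λ x s →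
        let t , F⇓ , t≤ = runs F x (x ∙ s)
            u , G⇓ , u≤ = runs G x (f x ∙ s)
        in  _ , seq assign (seq F⇓ (seq assign (seq assign (seq assign
                  (seq G⇓ (seq assign assign)))))) ,
            +-monoʳ-≤ 4 (+-mono-≤ t≤ (+-monoʳ-≤ 4 (+-monoʳ-≤ 4 (+-monoʳ-≤ 7 (+-monoˡ-≤ 8 u≤)))))
    ; small     = λ x → s≤s (+-mono-≤ (small F x) (small G x))
    }

  -- The language has no conditional. Two flags on the stack, the test and a true one, guard one
  -- loop each; `pop` clears both, so that a loop runs at most once, and the second one only if the
  -- first did not.
  if-PolyTime : ∀ {f g h} → PolyTime f → PolyTime g → PolyTime h →
                PolyTime (λ x → if truthy (f x) then g x else h x)
  if-PolyTime {f} {g} {h} F G H = record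
    { command   = command F×id ⨾ branch
    ; timeBound = timeBound F×id ⊕ branchTime
    ; sizeBound = sizeBound G ⊕ sizeBound H
    ; runs      = λ x s →
        let t , F⇓ , t≤ = runs F×id x s
            u , B⇓ , u≤ = branches (f x) x s
        in  t + u , seq F⇓ B⇓ , +-mono-≤ t≤ u≤
    ; small     = λ x → chosen-small (f x) x
    }
    where
    F×id : PolyTime (λ x → f x ∙ x)
    F×id = ∙-PolyTime F id-PolyTime

    pop branch : Command 2
    pop    = stack := cons nil (cons nil (tl (tl (var stack))))
    branch = stack := cons (hd (var val)) (cons (cons nil nil) (var stack))
           ⨾ val := tl (var val)
           ⨾ while hd (var stack) run (command G ⨾ pop)
           ⨾ while hd (tl (var stack)) run (command H ⨾ pop)
           ⨾ stack := tl (tl (var stack))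

    -- The overhead is 35 if the second loop is entered and 34 if the first one is.
    branchTime : Poly
    branchTime = K 35 ⊕ (timeBound G ⊕ timeBound H)

    chosen : Tree → Tree → Tree
    chosen b x = if truthy b then g x else h x

    chosen-small : ∀ b x → size (chosen b x) ≤ ⟪ sizeBound G ⊕ sizeBound H ⟫ (size x)
    chosen-small nil     x = m≤n⇒m≤o+n _ (small H x)
    chosen-small (_ ∙ _) x = m≤n⇒m≤n+o _ (small G x)

    branches : ∀ b x s → ∃[ t ] (⟨ branch , (b ∙ x) ∷ s ∷ [] ⟩⇓ chosen b x ∷ s ∷ [] steps t
                                 × t ≤ ⟪ branchTime ⟫ (size x))
    branches nil x s =
      let u , H⇓ , u≤ = runs H x (nil ∙ (nil ∙ nil) ∙ s)
      in  _ , seq assign (seq assign (seq (stop refl)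
                (seq (loop (λ ()) (seq H⇓ assign) (stop refl)) assign))) ,
          ≤-trans (≤-reflexive (lem u)) (+-monoʳ-≤ 35 (m≤n⇒m≤o+n _ u≤))
      where
      lem : ∀ u → 8 + (4 + (3 + (4 + (u + 8) + 4 + 4))) ≡ 35 + u
      lem = solve-∀
    branches (b₁ ∙ b₂) x s =
      let u , G⇓ , u≤ = runs G x ((b₁ ∙ b₂) ∙ (nil ∙ nil) ∙ s)
      in  _ , seq assign (seq assign (seq (loop (λ ()) (seq G⇓ assign) (stop refl))
                (seq (stop refl) assign))) ,
          ≤-trans (≤-reflexive (lem u)) (+-mono-≤ (n≤1+n 34) (m≤n⇒m≤n+o _ u≤))
      where
      lem : ∀ u → 8 + (4 + ((3 + (u + 8) + 3) + (4 + 4))) ≡ 34 + u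
      lem = solve-∀

module _ {step : Tree → Tree → Tree → Tree} {l i : Tree → Tree}
  (S : PolyTime (λ v → step (hdᵀ v) (hdᵀ (tlᵀ v)) (tlᵀ (tlᵀ v))))
  (L : PolyTime l) (I : PolyTime i)
  where

  private
    states : Tree → Tree → List Tree → Tree
    states e = foldl (λ s y → step y s e)

    hd-hd : PolyTime (λ v → hdᵀ (hdᵀ v))
    hd-hd = ∘-PolyTime hd-PolyTime hd-PolyTime

    tl-tl : PolyTime (λ v → tlᵀ (tlᵀ v))
    tl-tl = ∘-PolyTime tl-PolyTime tl-PolyTime

    round : PolyTime (λ v → tlᵀ (hdᵀ v) ∙ step (hdᵀ (hdᵀ v)) (hdᵀ (tlᵀ v)) (tlᵀ (tlᵀ v)) ∙ tlᵀ (tlᵀ v))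
    round = ∙-PolyTime (∘-PolyTime tl-PolyTime hd-PolyTime)
              (∙-PolyTime (∘-PolyTime S (∙-PolyTime hd-hd tl-PolyTime)) tl-tl)

    setup : PolyTime (λ e → l e ∙ i e ∙ e)
    setup = ∙-PolyTime L (∙-PolyTime I id-PolyTime)

    result : PolyTime (λ v → hdᵀ (tlᵀ v))
    result = ∘-PolyTime hd-PolyTime tl-PolyTime

    rounds : Command 2
    rounds = while hd (var val) run command round

    -- Each round pays for the state that it meets, so `b` has to bound the states after all
    -- prefixes of the list and not only the final one; `a` bounds what remains of the list.
    rounds⇓ : ∀ {a b} ys s e → size ys ≤ a →
      (∀ zs zs′ → zs ++ zs′ ≡ elems ys → size (states e s zs) ≤ b) → ∀ st →
      ∃[ t ] (⟨ rounds , (ys ∙ s ∙ e) ∷ st ∷ [] ⟩⇓ (nil ∙ states e s (elems ys) ∙ e) ∷ st ∷ [] steps t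
              × t ≤ 3 + length (elems ys) * (3 + ⟪ timeBound round ⟫ (2 + (a + (b + size e)))))
    rounds⇓ nil s e a≥ b≥ st = 3 , stop refl , ≤-refl
    rounds⇓ {a} {b} (y ∙ ys) s e a≥ b≥ st =
      let t , R⇓ , t≤ = runs round ((y ∙ ys) ∙ s ∙ e) st
          u , W⇓ , u≤ = rounds⇓ ys (step y s e) e
                          (≤-trans (m≤n⇒m≤1+n (m≤n+m (size ys) (size y))) a≥)
                          (λ zs zs′ eq → b≥ (y ∷ zs) zs′ (cong (y ∷_) eq)) st
          T = ⟪ timeBound round ⟫ (2 + (a + (b + size e)))
      in  3 + t + u , loop (λ ()) R⇓ W⇓ , (begin
            3 + t + u                                     ≤⟨ +-mono-≤ (+-monoʳ-≤ 3 (≤-trans t≤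
                                                               (⟪⟫-mono (timeBound round) size≤))) u≤ ⟩
            3 + T + (3 + length (elems ys) * (3 + T))     ≡⟨ rearrange (3 + T) _ ⟩
            3 + (3 + T + length (elems ys) * (3 + T))     ∎)
      where
      open ≤-Reasoning
      rearrange : ∀ x y → x + (3 + y) ≡ 3 + (x + y)
      rearrange = solve-∀
      size≤ : size ((y ∙ ys) ∙ s ∙ e) ≤ 2 + (a + (b + size e))
      size≤ = s≤s (≤-trans (+-monoʳ-≤ (size (y ∙ ys)) (s≤s (+-monoˡ-≤ (size e) (b≥ [] _ refl))))
                   (≤-trans (≤-reflexive (+-suc (size (y ∙ ys)) (b + size e))) (s≤s (+-monoˡ-≤ (b + size e) a≥))))

  opaque
    bounded-foldl-PolyTime : (b : Poly) →
      (∀ e zs zs′ → zs ++ zs′ ≡ elems (l e) → size (foldl (λ s y → step y s e) (i e) zs) ≤ ⟪ b ⟫ (size e)) →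
      PolyTime (λ e → foldl (λ s y → step y s e) (i e) (elems (l e)))
    bounded-foldl-PolyTime b b≥ = record
      { command   = command setup ⨾ rounds ⨾ command result
      ; timeBound = timeBound setup ⊕ (loopTime ⊕ timeBound result ⟨ K 1 ⊕ (K 1 ⊕ (K 1 ⊕ (b ⊕ X))) ⟩)
      ; sizeBound = b
      ; runs      = λ e st →
          let t , S⇓ , t≤ = runs setup e st
              u , W⇓ , u≤ = rounds⇓ (l e) (i e) e (small L e) (b≥ e) st
              v , R⇓ , v≤ = runs result (nil ∙ states e (i e) (elems (l e)) ∙ e) st
          in  t + (u + v) , seq S⇓ (seq W⇓ R⇓) ,
              +-mono-≤ t≤ (+-mono-≤
                (≤-trans u≤ (+-monoʳ-≤ 3 (*-mono-≤ (≤-trans (length-elems (l e)) (small L e))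
                  (+-monoʳ-≤ 3 (≤-reflexive (sym (⟪⟫-∘ (timeBound round) _ (size e))))))))
                (≤-trans v≤ (⟪⟫-subst (timeBound result) (K 1 ⊕ (K 1 ⊕ (K 1 ⊕ (b ⊕ X))))
                  (s≤s (s≤s (s≤s (+-monoˡ-≤ (size e) (full e))))))))
      ; small     = full
      }
      where
      full : ∀ e → size (foldl (λ s y → step y s e) (i e) (elems (l e))) ≤ ⟪ b ⟫ (size e)
      full e = b≥ e (elems (l e)) [] (++-identityʳ _)

      loopTime : Poly
      loopTime = K 3 ⊕ sizeBound L ⊗ (K 3 ⊕ timeBound round ⟨ K 2 ⊕ (sizeBound L ⊕ (b ⊕ X)) ⟩)

    -- The size of the old state enters the hypothesis with coefficient one, so that the increments
    -- merely add up over the list; any larger coefficient could lead to exponential growth.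
    foldl-PolyTime : (q : Poly) →
      (∀ y s e → size (step y s e) ≤ size s + ⟪ q ⟫ (size y + size e)) →
      PolyTime (λ e → foldl (λ s y → step y s e) (i e) (elems (l e)))
    foldl-PolyTime q growth = bounded-foldl-PolyTime (sizeBound I ⊕ sizeBound L ⊗ q ⟨ sizeBound L ⊕ X ⟩)
      λ e zs zs′ eq → ≤-trans (prefix (l e) (i e) e zs zs′ ≤-refl eq)
        (+-mono-≤ (small I e) (*-mono-≤ (small L e) (⟪⟫-subst q (sizeBound L ⊕ X) (+-monoˡ-≤ (size e) (small L e)))))
      where
      open ≤-Reasoning
      prefix : ∀ {a} ys s e zs zs′ → size ys ≤ a → zs ++ zs′ ≡ elems ys →
               size (states e s zs) ≤ size s + size ys * ⟪ q ⟫ (a + size e)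
      prefix ys s e [] zs′ ys≤a eq = m≤m+n _ _
      prefix {a} (y ∙ ys) s e (_ ∷ zs) zs′ ys≤a eq with refl , eq′ ← ∷-injective eq = begin
        size (states e (step y s e) zs)           ≤⟨ prefix ys (step y s e) e zs zs′
                                                       (≤-trans (m≤n+m (size ys) (suc (size y))) ys≤a) eq′ ⟩
        size (step y s e) + size ys * Q           ≤⟨ +-monoˡ-≤ _ (growth y s e) ⟩
        size s + ⟪ q ⟫ (size y + size e) + size ys * Q ≤⟨ +-monoˡ-≤ _ (+-monoʳ-≤ (size s)
                                                       (⟪⟫-mono q (+-monoˡ-≤ (size e)
                                                         (≤-trans (m≤n⇒m≤1+n (m≤m+n (size y) (size ys))) ys≤a)))) ⟩
        size s + Q + size ys * Q                  ≡⟨ +-assoc (size s) Q _ ⟩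
        size s + suc (size ys) * Q                ≤⟨ +-monoʳ-≤ (size s) (*-monoˡ-≤ Q (s≤s (m≤n+m (size ys) (size y)))) ⟩
        size s + size (y ∙ ys) * Q                ∎
        where
        Q : ℕ
        Q = ⟪ q ⟫ (a + size e)

-- Polynomial-time functions of several variables

toVec : ∀ k → Tree → Vec Tree k
toVec zero    e = []
toVec (suc k) e = hdᵀ e ∷ toVec k (tlᵀ e)

-- The values of all variables are passed as one nested pair, the innermost variable in front, so
-- that binding a variable is a single `_∙_`.
record Fun (k : ℕ) : Set where
  no-eta-equality
  field
    fn   : Vec Tree k → Tree
    poly : PolyTime (fn ∘ toVec k)

open Fun

infix 9 #_

#_ : ∀ {k} → Fin k → Fun k
# i = record { fn = λ ρ → lookup ρ i ; poly = lookup-PolyTime i }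
  where
  lookup-PolyTime : ∀ {k} (i : Fin k) → PolyTime (λ e → lookup (toVec k e) i)
  lookup-PolyTime zero    = hd-PolyTime
  lookup-PolyTime (suc i) = ∘-PolyTime (lookup-PolyTime i) tl-PolyTime

size-lookup : ∀ k e (i : Fin k) → size (lookup (toVec k e) i) ≤ size e
size-lookup (suc k) e zero    = size-hd e
size-lookup (suc k) e (suc i) = ≤-trans (size-lookup k (tlᵀ e) i) (size-tl e)

nilF : ∀ {k} → Fun k
nilF = record { fn = λ _ → nil ; poly = nil-PolyTime }

infixr 5 _∙F_

_∙F_ : ∀ {k} → Fun k → Fun k → Fun k
f ∙F g = record { fn = λ ρ → fn f ρ ∙ fn g ρ ; poly = ∙-PolyTime (poly f) (poly g) }

hdF tlF : ∀ {k} → Fun k → Fun k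
hdF f = record { fn = λ ρ → hdᵀ (fn f ρ) ; poly = ∘-PolyTime hd-PolyTime (poly f) }
tlF f = record { fn = λ ρ → tlᵀ (fn f ρ) ; poly = ∘-PolyTime tl-PolyTime (poly f) }

ifF : ∀ {k} → Fun k → Fun k → Fun k → Fun k
ifF f g h = record
  { fn   = λ ρ → if truthy (fn f ρ) then fn g ρ else fn h ρ
  ; poly = if-PolyTime (poly f) (poly g) (poly h)
  }

letF : ∀ {k} → Fun k → Fun (suc k) → Fun k
letF f g = record
  { fn   = λ ρ → fn g (fn f ρ ∷ ρ)
  ; poly = ∘-PolyTime (poly g) (∙-PolyTime (poly f) id-PolyTime)
  }

-- Hides the accumulator of a fold from a body that was written without it.
skip : ∀ {k} → Fun (suc k) → Fun (suc (suc k))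
skip f = record
  { fn   = λ { (y ∷ _ ∷ ρ) → fn f (y ∷ ρ) }
  ; poly = ∘-PolyTime (poly f) (∙-PolyTime hd-PolyTime (∘-PolyTime tl-PolyTime tl-PolyTime))
  }

Growth : ∀ {k} → Fun (suc (suc k)) → Set
Growth {k} b = ∃[ q ] ∀ y s e → size (fn b (y ∷ s ∷ toVec k e)) ≤ size s + ⟪ q ⟫ (size y + size e)

foldlF : ∀ {k} → Fun k → Fun k → (b : Fun (suc (suc k))) → Growth b → Fun k
foldlF l i b (q , growth) = record
  { fn   = λ ρ → foldl (λ s y → fn b (y ∷ s ∷ ρ)) (fn i ρ) (elems (fn l ρ))
  ; poly = foldl-PolyTime (poly b) (poly l) (poly i) q growth
  }

reverseF : ∀ {k} → Fun k → Fun k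
reverseF l = foldlF l nilF (# zero ∙F # (suc zero))
  (X ⊕ K 1 , λ y s e → ≤-trans (≤-reflexive (+-comm (suc (size y)) (size s)))
    (+-monoʳ-≤ (size s) (≤-trans (≤-reflexive (+-comm 1 (size y))) (+-monoˡ-≤ 1 (m≤m+n (size y) (size e))))))

elems-reverse : ∀ {k} (l : Fun k) ρ → elems (fn (reverseF l) ρ) ≡ reverse (elems (fn l ρ))
elems-reverse l ρ = go nil (elems (fn l ρ))
  where
  go : ∀ a xs → elems (foldl (λ s y → y ∙ s) a xs) ≡ foldl (flip _∷_) (elems a) xs
  go a []       = refl
  go a (x ∷ xs) = go (x ∙ a) xs

-- A loop meets the front of the list first, hence the reversal.
foldrF : ∀ {k} → Fun k → Fun k → (b : Fun (suc (suc k))) → Growth b → Fun k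
foldrF {k} l i b growth = record
  { fn   = λ ρ → foldr (λ y s → fn b (y ∷ s ∷ ρ)) (fn i ρ) (elems (fn l ρ))
  ; poly = ≗-PolyTime (λ e → from-reverse (toVec k e)) (poly (foldlF (reverseF l) i b growth))
  }
  where
  from-reverse : ∀ ρ → fn (foldlF (reverseF l) i b growth) ρ
                     ≡ foldr (λ y s → fn b (y ∷ s ∷ ρ)) (fn i ρ) (elems (fn l ρ))
  from-reverse ρ rewrite elems-reverse l ρ = reverse-foldl _ (fn i ρ) (elems (fn l ρ))

filterᵀ : (Tree → Bool) → Tree → Tree
filterᵀ p nil     = nil
filterᵀ p (s ∙ t) = if p s then s ∙ filterᵀ p t else filterᵀ p t

size-filterᵀ : ∀ p t → size (filterᵀ p t) ≤ size t
size-filterᵀ p nil     = ≤-refl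
size-filterᵀ p (s ∙ t) with p s
... | true  = s≤s (+-monoʳ-≤ (size s) (size-filterᵀ p t))
... | false = m≤n⇒m≤1+n (m≤n⇒m≤o+n (size s) (size-filterᵀ p t))

-- A non-empty list is true, so that filtering also serves as bounded
-- existential quantification.
filterF : ∀ {k} → Fun k → Fun (suc k) → Fun k
filterF {k} l φ = record
  { fn   = λ ρ → filterᵀ (λ y → truthy (fn φ (y ∷ ρ))) (fn l ρ)
  ; poly = ≗-PolyTime (λ e → go (toVec k e) (fn l (toVec k e)))
             (poly (foldrF l nilF (ifF (skip φ) (# zero ∙F # (suc zero)) (# (suc zero))) (K 1 ⊕ X , growth)))
  }
  where
  go : ∀ ρ t → foldr (λ y s → if truthy (fn φ (y ∷ ρ)) then y ∙ s else s) nil (elems t)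
             ≡ filterᵀ (λ y → truthy (fn φ (y ∷ ρ))) t
  go ρ nil     = refl
  go ρ (s ∙ t) rewrite go ρ t = refl

  growth : ∀ y s e → size (if truthy (fn φ (y ∷ toVec k e)) then y ∙ s else s)
                   ≤ size s + suc (size y + size e)
  growth y s e with truthy (fn φ (y ∷ toVec k e))
  ... | true  = ≤-trans (≤-reflexive (+-comm (suc (size y)) (size s)))
                  (+-monoʳ-≤ (size s) (s≤s (m≤m+n (size y) (size e))))
  ... | false = m≤m+n (size s) _

infixr 5 _++ᵀ_

_++ᵀ_ : Tree → Tree → Tree
nil     ++ᵀ u = u
(s ∙ t) ++ᵀ u = s ∙ (t ++ᵀ u)

size-++ᵀ : ∀ t u → size (t ++ᵀ u) ≤ size u + size t
size-++ᵀ nil     u = m≤m+n (size u) 1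
size-++ᵀ (s ∙ t) u = begin
  suc (size s + size (t ++ᵀ u))      ≤⟨ s≤s (+-monoʳ-≤ (size s) (size-++ᵀ t u)) ⟩
  suc (size s + (size u + size t))   ≡⟨ cong suc (x∙yz≈y∙xz (size s) (size u) (size t)) ⟩
  suc (size u + (size s + size t))   ≡⟨ +-suc (size u) _ ⟨
  size u + suc (size s + size t)     ∎
  where
  open ≤-Reasoning
  open import Algebra.Properties.CommutativeSemigroup +-commutativeSemigroup using (x∙yz≈y∙xz)

infixr 5 _++F_

_++F_ : ∀ {k} → Fun k → Fun k → Fun k
_++F_ {k} f g = record
  { fn   = λ ρ → fn f ρ ++ᵀ fn g ρ
  ; poly = ≗-PolyTime (λ e → go (fn f (toVec k e)) (fn g (toVec k e)))
             (poly (foldrF f g (# zero ∙F # (suc zero)) (K 1 ⊕ X , growth)))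
  }
  where
  go : ∀ t u → foldr _∙_ u (elems t) ≡ t ++ᵀ u
  go nil     u = refl
  go (s ∙ t) u = cong (s ∙_) (go t u)

  growth : ∀ y s e → suc (size y + size s) ≤ size s + suc (size y + size e)
  growth y s e = ≤-trans (≤-reflexive (+-comm (suc (size y)) (size s)))
                   (+-monoʳ-≤ (size s) (s≤s (m≤m+n (size y) (size e))))

concatMapᵀ : (Tree → Tree) → Tree → Tree
concatMapᵀ f nil     = nil
concatMapᵀ f (s ∙ t) = f s ++ᵀ concatMapᵀ f t

concatMapF : ∀ {k} → Fun k → Fun (suc k) → Fun k
concatMapF {k} l φ = record
  { fn   = λ ρ → concatMapᵀ (λ y → fn φ (y ∷ ρ)) (fn l ρ)
  ; poly = ≗-PolyTime (λ e → go (toVec k e) (fn l (toVec k e)))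
             (poly (foldrF l nilF (skip φ ++F # (suc zero)) (sizeBound (poly φ) ⟨ K 1 ⊕ X ⟩ , growth)))
  }
  where
  go : ∀ ρ t → foldr (λ y s → fn φ (y ∷ ρ) ++ᵀ s) nil (elems t) ≡ concatMapᵀ (λ y → fn φ (y ∷ ρ)) t
  go ρ nil     = refl
  go ρ (s ∙ t) = cong (fn φ (s ∷ ρ) ++ᵀ_) (go ρ t)

  growth : ∀ y s e → size (fn φ (y ∷ toVec k e) ++ᵀ s)
                   ≤ size s + ⟪ sizeBound (poly φ) ⟨ K 1 ⊕ X ⟩ ⟫ (size y + size e)
  growth y s e = ≤-trans (size-++ᵀ (fn φ (y ∷ toVec k e)) s) (+-monoʳ-≤ (size s)
    (≤-trans (small (poly φ) (y ∙ e)) (≤-reflexive (sym (⟪⟫-∘ (sizeBound (poly φ)) (K 1 ⊕ X) _)))))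

trueF : ∀ {k} → Fun k
trueF = nilF ∙F nilF

notF : ∀ {k} → Fun k → Fun k
notF f = ifF f nilF trueF

_∧F_ _∨F_ : ∀ {k} → Fun k → Fun k → Fun k
f ∧F g = ifF f g nilF
f ∨F g = ifF f trueF g

⟦_⟧ : ∀ {k} → Fun k → Vec Tree k → Bool
⟦ f ⟧ ρ = truthy (fn f ρ)

⟦not⟧ : ∀ {k} (f : Fun k) ρ → ⟦ notF f ⟧ ρ ≡ not (⟦ f ⟧ ρ)
⟦not⟧ f ρ with truthy (fn f ρ)
... | true  = refl
... | false = refl

⟦∧⟧ : ∀ {k} (f g : Fun k) ρ → ⟦ f ∧F g ⟧ ρ ≡ ⟦ f ⟧ ρ ∧ ⟦ g ⟧ ρ
⟦∧⟧ f g ρ with truthy (fn f ρ)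
... | true  = refl
... | false = refl

⟦∨⟧ : ∀ {k} (f g : Fun k) ρ → ⟦ f ∨F g ⟧ ρ ≡ ⟦ f ⟧ ρ ∨ ⟦ g ⟧ ρ
⟦∨⟧ f g ρ with truthy (fn f ρ)
... | true  = refl
... | false = refl

-- The list is known when the program is built, so the connectives are unrolled and need no loop.
allF anyF : ∀ {k} {A : Set} → (A → Fun k) → List A → Fun k
allF f = foldr (λ x g → f x ∧F g) trueF
anyF f = foldr (λ x g → f x ∨F g) nilF

⟦all⟧ : ∀ {k} {A : Set} (f : A → Fun k) ρ {p : A → Bool} → (∀ x → ⟦ f x ⟧ ρ ≡ p x) →
        ∀ xs → ⟦ allF f xs ⟧ ρ ≡ all p xs
⟦all⟧ f ρ eq []       = refl
⟦all⟧ f ρ eq (x ∷ xs) = trans (⟦∧⟧ (f x) (allF f xs) ρ) (cong₂ _∧_ (eq x) (⟦all⟧ f ρ eq xs))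

⟦any⟧ : ∀ {k} {A : Set} (f : A → Fun k) ρ {p : A → Bool} → (∀ x → ⟦ f x ⟧ ρ ≡ p x) →
        ∀ xs → ⟦ anyF f xs ⟧ ρ ≡ any p xs
⟦any⟧ f ρ eq []       = refl
⟦any⟧ f ρ eq (x ∷ xs) = trans (⟦∨⟧ (f x) (anyF f xs) ρ) (cong₂ _∨_ (eq x) (⟦any⟧ f ρ eq xs))

list : {A : Set} → (A → Tree) → List A → Tree
list c xs = encodeList (map c xs)

++ᵀ-list : ∀ {A : Set} (c : A → Tree) xs ys → list c xs ++ᵀ list c ys ≡ list c (xs ++ ys)
++ᵀ-list c []       ys = refl
++ᵀ-list c (x ∷ xs) ys = cong (c x ∙_) (++ᵀ-list c xs ys)

module _ {A : Set} (c : A → Tree) where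

  filterᵀ-list : ∀ {p q} → (∀ x → p (c x) ≡ q x) → ∀ xs →
                 filterᵀ p (list c xs) ≡ list c (filterᵇ q xs)
  filterᵀ-list eq []       = refl
  filterᵀ-list {p} {q} eq (x ∷ xs) rewrite eq x with q x
  ... | true  = cong (c x ∙_) (filterᵀ-list eq xs)
  ... | false = filterᵀ-list eq xs

  truthy-filter : ∀ q xs → truthy (list c (filterᵇ q xs)) ≡ any q xs
  truthy-filter q []       = refl
  truthy-filter q (x ∷ xs) with q x
  ... | true  = refl
  ... | false = truthy-filter q xs

  elems-list : ∀ xs → elems (list c xs) ≡ map c xs
  elems-list []       = refl
  elems-list (x ∷ xs) = cong (c x ∷_) (elems-list xs)

  filterF-list : ∀ {k} (l : Fun k) φ ρ {xs q} → fn l ρ ≡ list c xs → (∀ x → ⟦ φ ⟧ (c x ∷ ρ) ≡ q x) →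
                 fn (filterF l φ) ρ ≡ list c (filterᵇ q xs)
  filterF-list l φ ρ {xs} l≡ eq rewrite l≡ = filterᵀ-list eq xs

  filterF-any : ∀ {k} (l : Fun k) φ ρ {xs q} → fn l ρ ≡ list c xs → (∀ x → ⟦ φ ⟧ (c x ∷ ρ) ≡ q x) →
                ⟦ filterF l φ ⟧ ρ ≡ any q xs
  filterF-any l φ ρ {xs} {q} l≡ eq = trans (cong truthy (filterF-list l φ ρ l≡ eq)) (truthy-filter q xs)

  foldr-list : ∀ {B : Set} (d : B → Tree) {f : Tree → Tree → Tree} {g : A → B → B} {i z} → i ≡ d z →
               (∀ x s → f (c x) (d s) ≡ d (g x s)) → ∀ {l xs} → l ≡ list c xs →
               foldr f i (elems l) ≡ d (foldr g z xs)
  foldr-list d refl eq {xs = []}     refl = refl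
  foldr-list d {f} refl eq {xs = x ∷ xs} refl =
    trans (cong (f (c x)) (foldr-list d refl eq {xs = xs} refl)) (eq x _)

  concatMapᵀ-list : ∀ {B : Set} (d : B → Tree) {f : Tree → Tree} {g : A → List B} →
                    (∀ x → f (c x) ≡ list d (g x)) → ∀ xs →
                    concatMapᵀ f (list c xs) ≡ list d (concatMap g xs)
  concatMapᵀ-list d eq []       = refl
  concatMapᵀ-list d {g = g} eq (x ∷ xs) = trans
    (cong₂ _++ᵀ_ (eq x) (concatMapᵀ-list d eq xs)) (++ᵀ-list d (g x) (concatMap g xs))

PolyTime⇒Program : ∀ {f} → PolyTime f → Σ[ P ∈ Program ] ∃[ c ] ∃[ d ]
  ∀ x b → f x ≡ encodeBool b → ∃[ t ] (Outputs P x b t × t ≤ c * size x ^ d)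
PolyTime⇒Program F with c , d , time≤ ← monomial-bound (timeBound F) =
  record { others = 1 ; body = command F } , c , d , λ x b fx≡b →
    let t , F⇓ , t≤ = runs F x nil
    in  t , (_ , F⇓ , fx≡b) , ≤-trans t≤ (time≤ (size x) (size≥1 x))

-- The algorithm on an abstract conflict graph

module Algorithm {A : Set} (same conf : A → A → Bool) where

  -- Whether any transitive orientation of the graph of the pairs that are not
  -- in conflict that contains the first pair contains the second one, too.
  Γ : A × A → A × A → Bool
  Γ (x , y) (x′ , y′) = (same x x′ ∧ conf y y′) ∨ (same y y′ ∧ conf x x′)

  edges : List A → List (A × A)
  edges W = concatMap (λ x → concatMap (λ y → if conf x y then [] else [ x , y ]) W) W

  grow : List (A × A) → List (A × A) → List (A × A)
  grow U R = filterᵇ (λ t → any (λ r → Γ r t) R) U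

  -- `U` also serves as the counter: a round that does not find the set closed adds an element of
  -- `U`.
  class : List (A × A) → A × A → List (A × A)
  class U e = foldr (λ _ R → grow U R) (filterᵇ (Γ e) U) U

  -- For edges this is membership in `O`, because `O` will be closed under forcing and every edge
  -- forces itself.
  oriented : List (A × A) → A × A → Bool
  oriented O e = any (λ r → Γ r e) O

  extend : List (A × A) → A × A → List (A × A) → List (A × A)
  extend U e O = if oriented O e ∨ oriented O (swap e) then O else class U e ++ O

  orient : List (A × A) → List (A × A)
  orient U = foldr (extend U) [] U

  -- `oriented` can be trusted only on edges, hence the additional test for a conflict.
  next : List A → List (A × A) → List A → List A
  next W O L = filterᵇ (λ y → any (λ x → not (conf x y) ∧ oriented O (x , y)) L) W

  push : List A → List (A × A) → List (List A) → List (List A)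
  push W O []              = []
  push W O ([] ∷ s)        = [] ∷ s
  push W O ((x ∷ L) ∷ s)   = next W O (x ∷ L) ∷ (x ∷ L) ∷ s

  -- The bottom of the stack is there for its length: it exceeds by one the
  -- size of a largest independent set that consists of one further element
  -- and of elements of W, provided that there are enough rounds.
  layers : ∀ {B : Set} → List B → List A → List (List A)
  layers rounds W = foldr (λ _ → push W (orient (edges W))) (W ∷ [] ∷ []) rounds

-- Vertices, tuples and numbers as trees

unary : ℕ → Tree
unary zero    = nil
unary (suc j) = nil ∙ unary j

truthy-unary : ∀ j → truthy (unary j) ≡ (0 <ᵇ j)
truthy-unary zero    = refl
truthy-unary (suc j) = refl

size-foldr : ∀ {f : Tree → Tree → Tree} {i a} xs → size i ≤ a → (∀ y s → size s ≤ a → size (f y s) ≤ a) →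
             size (foldr f i xs) ≤ a
size-foldr []       i≤ f≤ = i≤
size-foldr (x ∷ xs) i≤ f≤ = f≤ x _ (size-foldr xs i≤ f≤)

-- Serves as access by index if `l` is a list, and as truncated subtraction if `l` is a unary
-- number; two numbers are equal when both differences vanish.
dropF : ∀ {k} → Fun k → Fun k → Fun k
dropF u l = foldrF u l (tlF (# 1F)) (K 0 , λ y s e → m≤n⇒m≤n+o 0 (size-tl s))

dropᵀ : ℕ → Tree → Tree
dropᵀ zero    t = t
dropᵀ (suc j) t = dropᵀ j (tlᵀ t)

dropᵀ-nil : ∀ j → dropᵀ j nil ≡ nil
dropᵀ-nil zero    = refl
dropᵀ-nil (suc j) = dropᵀ-nil j

tl-dropᵀ : ∀ j t → tlᵀ (dropᵀ j t) ≡ dropᵀ j (tlᵀ t)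
tl-dropᵀ zero    t = refl
tl-dropᵀ (suc j) t = tl-dropᵀ j (tlᵀ t)

fn-drop : ∀ {k} (u l : Fun k) ρ → fn (dropF u l) ρ ≡ dropᵀ (length (elems (fn u ρ))) (fn l ρ)
fn-drop u l ρ = go (elems (fn u ρ))
  where
  go : ∀ xs → foldr (λ _ s → tlᵀ s) (fn l ρ) xs ≡ dropᵀ (length xs) (fn l ρ)
  go []       = refl
  go (x ∷ xs) = trans (cong tlᵀ (go xs)) (tl-dropᵀ (length xs) (fn l ρ))

length-unary : ∀ j → length (elems (unary j)) ≡ j
length-unary zero    = refl
length-unary (suc j) = cong suc (length-unary j)

fn-drop-unary : ∀ {k} (u l : Fun k) ρ {j t} → fn u ρ ≡ unary j → fn l ρ ≡ t → fn (dropF u l) ρ ≡ dropᵀ j t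
fn-drop-unary u l ρ {j} {t} u≡ refl = trans (fn-drop u l ρ)
  (cong (λ i → dropᵀ i t) (trans (cong (length ∘ elems) u≡) (length-unary j)))

dropᵀ-unary : ∀ i j → dropᵀ i (unary j) ≡ unary (j ∸ i)
dropᵀ-unary zero    j       = refl
dropᵀ-unary (suc i) zero    = dropᵀ-nil i
dropᵀ-unary (suc i) (suc j) = dropᵀ-unary i j

hd-dropᵀ-tabulate : ∀ {n} (f : Fin n → Tree) i → hdᵀ (dropᵀ (toℕ i) (encodeList (tabulate f))) ≡ f i
hd-dropᵀ-tabulate f zero    = refl
hd-dropᵀ-tabulate f (suc i) = hd-dropᵀ-tabulate (f ∘ suc) i

vertex : ∀ {n} → Fin n → Tree
vertex = unary ∘ toℕ

sameVertex : ∀ {n} → Fin n → Fin n → Bool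
sameVertex a b = toℕ a ≡ᵇ toℕ b

opaque
  adjF : ∀ {k} → Fun k → Fun k → Fun k → Fun k
  adjF rows u w = hdF (dropF w (hdF (dropF u rows)))

  ⟦adj⟧ : ∀ {k n} (G : Graph n) (rows u w : Fun k) ρ {a b} → fn rows ρ ≡ encodeGraph G →
          fn u ρ ≡ vertex a → fn w ρ ≡ vertex b → ⟦ adjF rows u w ⟧ ρ ≡ adj G a b
  ⟦adj⟧ G rows u w ρ {a} {b} r≡ u≡ w≡ = trans (cong truthy (trans
    (cong hdᵀ (fn-drop-unary w (hdF (dropF u rows)) ρ w≡
      (trans (cong hdᵀ (fn-drop-unary u rows ρ u≡ r≡)) (hd-dropᵀ-tabulate _ a))))
    (hd-dropᵀ-tabulate _ b))) (truthy-encodeBool (adj G a b))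
    where
    truthy-encodeBool : ∀ b → truthy (encodeBool b) ≡ b
    truthy-encodeBool true  = refl
    truthy-encodeBool false = refl

  sameF : ∀ {k} → Fun k → Fun k → Fun k
  sameF u w = notF (dropF u w) ∧F notF (dropF w u)

  ⟦same⟧ : ∀ {k n} (u w : Fun k) ρ {a b : Fin n} → fn u ρ ≡ vertex a → fn w ρ ≡ vertex b →
           ⟦ sameF u w ⟧ ρ ≡ sameVertex a b
  ⟦same⟧ u w ρ {a} {b} u≡ w≡ = trans (⟦∧⟧ (notF (dropF u w)) (notF (dropF w u)) ρ) (trans
    (cong₂ _∧_ (side u w u≡ w≡) (side w u w≡ u≡)) (go (toℕ a) (toℕ b)))
    where
    side : ∀ u w {i j} → fn u ρ ≡ unary i → fn w ρ ≡ unary j → ⟦ notF (dropF u w) ⟧ ρ ≡ not (0 <ᵇ (j ∸ i))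
    side u w {i} {j} u≡ w≡ = trans (⟦not⟧ (dropF u w) ρ) (cong not (trans
      (cong truthy (trans (fn-drop-unary u w ρ u≡ w≡) (dropᵀ-unary i j))) (truthy-unary (j ∸ i))))

    go : ∀ i j → not (0 <ᵇ (j ∸ i)) ∧ not (0 <ᵇ (i ∸ j)) ≡ (i ≡ᵇ j)
    go zero    zero    = refl
    go zero    (suc j) = refl
    go (suc i) zero    = refl
    go (suc i) (suc j) = go i j

tuple : ∀ {n m} → Vec (Fin n) m → Tree
tuple []       = nil
tuple (a ∷ as) = vertex a ∙ tuple as

nthF : ∀ {k m} → Fun k → Fin m → Fun k
nthF f zero    = hdF f
nthF f (suc i) = nthF (tlF f) i

fn-nth : ∀ {k m n} (f : Fun k) ρ {x : Vec (Fin n) m} → fn f ρ ≡ tuple x → ∀ i →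
         fn (nthF f i) ρ ≡ vertex (lookup x i)
fn-nth f ρ {_ ∷ _} f≡ zero    = cong hdᵀ f≡
fn-nth f ρ {_ ∷ _} f≡ (suc i) = fn-nth (tlF f) ρ (cong tlᵀ f≡) i

pairᵀ : ∀ {n m} → Vec (Fin n) m × Vec (Fin n) m → Tree
pairᵀ (x , y) = tuple x ∙ tuple y

module Tuples (m : ℕ) where

  sameTuple : ∀ {n} → Vec (Fin n) m → Vec (Fin n) m → Bool
  sameTuple x y = all (λ i → sameVertex (lookup x i) (lookup y i)) (allFin m)

  conflict : ∀ {n} → Graph n → Vec (Fin n) m → Vec (Fin n) m → Bool
  conflict G x y = any (λ i → any (λ j → sameVertex (lookup x i) (lookup y j) ∨ adj G (lookup x i) (lookup y j))
                     (allFin m)) (allFin m)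

  isEmbedding : ∀ {n} → Graph m → Graph n → Vec (Fin n) m → Bool
  isEmbedding H G x = all (λ i → all (λ j →
      (if adj H i j then adj G (lookup x i) (lookup x j) else not (adj G (lookup x i) (lookup x j)))
      ∧ (sameVertex i j ∨ not (sameVertex (lookup x i) (lookup x j))))
    (allFin m)) (allFin m)

  module _ {k : ℕ} where

    module _ (x y : Fun k) where

      opaque
        sameAtF : Fin m → Fun k
        sameAtF i = sameF (nthF x i) (nthF y i)

        sameTupleF : Fun k
        sameTupleF = allF sameAtF (allFin m)

      module _ (rows : Fun k) where

        opaque
          conflictAtF : Fin m → Fin m → Fun k
          conflictAtF i j = sameF (nthF x i) (nthF y j) ∨F adjF rows (nthF x i) (nthF y j)

          conflictFromF : Fin m → Fun k
          conflictFromF i = anyF (conflictAtF i) (allFin m)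

          conflictF : Fun k
          conflictF = anyF conflictFromF (allFin m)

    opaque
      unfolding sameTupleF conflictF

      ⟦sameTuple⟧ : ∀ {n} (f g : Fun k) ρ {x y : Vec (Fin n) m} → fn f ρ ≡ tuple x → fn g ρ ≡ tuple y →
                    ⟦ sameTupleF f g ⟧ ρ ≡ sameTuple x y
      ⟦sameTuple⟧ f g ρ f≡ g≡ = ⟦all⟧ (sameAtF f g) ρ
        (λ i → ⟦same⟧ (nthF f i) (nthF g i) ρ (fn-nth f ρ f≡ i) (fn-nth g ρ g≡ i)) (allFin m)

      ⟦conflict⟧ : ∀ {n} (G : Graph n) (rows : Fun k) (ρ : Vec Tree k) (rows≡ : fn rows ρ ≡ encodeGraph G) →
                   ∀ f g {x y : Vec (Fin n) m} → fn f ρ ≡ tuple x → fn g ρ ≡ tuple y →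
                   ⟦ conflictF f g rows ⟧ ρ ≡ conflict G x y
      ⟦conflict⟧ G rows ρ rows≡ f g {x} {y} f≡ g≡ = ⟦any⟧ (conflictFromF f g rows) ρ (λ i →
        ⟦any⟧ (conflictAtF f g rows i) ρ (λ j → at i j) (allFin m)) (allFin m)
        where
        at : ∀ i j → ⟦ conflictAtF f g rows i j ⟧ ρ ≡
                     sameVertex (lookup x i) (lookup y j) ∨ adj G (lookup x i) (lookup y j)
        at i j = trans (⟦∨⟧ (sameF (nthF f i) (nthF g j)) (adjF rows (nthF f i) (nthF g j)) ρ) (cong₂ _∨_
          (⟦same⟧ (nthF f i) (nthF g j) ρ (fn-nth f ρ f≡ i) (fn-nth g ρ g≡ j))
          (⟦adj⟧ G rows (nthF f i) (nthF g j) ρ rows≡ (fn-nth f ρ f≡ i) (fn-nth g ρ g≡ j)))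

    module _ (H : Graph m) (rows x : Fun k) where

      opaque
        -- As `H` is fixed, its adjacencies are evaluated while the program is built; only the tests
        -- on `G` are left to be run.
        edgeF distinctF embeddingAtF : Fin m → Fin m → Fun k
        edgeF i j        = if adj H i j then adjF rows (nthF x i) (nthF x j) else notF (adjF rows (nthF x i) (nthF x j))
        distinctF i j    = if sameVertex i j then trueF else notF (sameF (nthF x i) (nthF x j))
        embeddingAtF i j = edgeF i j ∧F distinctF i j

        embeddingFromF : Fin m → Fun k
        embeddingFromF i = allF (embeddingAtF i) (allFin m)

        isEmbeddingF : Fun k
        isEmbeddingF = allF embeddingFromF (allFin m)

    opaque
      unfolding isEmbeddingF

      ⟦isEmbedding⟧ : ∀ {n} (G : Graph n) (rows : Fun k) (ρ : Vec Tree k) (rows≡ : fn rows ρ ≡ encodeGraph G) →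
                      ∀ H f {x : Vec (Fin n) m} → fn f ρ ≡ tuple x →
                      ⟦ isEmbeddingF H rows f ⟧ ρ ≡ isEmbedding H G x
      ⟦isEmbedding⟧ G rows ρ rows≡ H f {x} f≡ = ⟦all⟧ (embeddingFromF H rows f) ρ (λ i →
        ⟦all⟧ (embeddingAtF H rows f i) ρ (λ j →
          trans (⟦∧⟧ (edgeF H rows f i j) (distinctF H rows f i j) ρ) (cong₂ _∧_ (edge≡ i j) (distinct≡ i j)))
        (allFin m)) (allFin m)
        where
        adj≡ : ∀ i j → ⟦ adjF rows (nthF f i) (nthF f j) ⟧ ρ ≡ adj G (lookup x i) (lookup x j)
        adj≡ i j = ⟦adj⟧ G rows (nthF f i) (nthF f j) ρ rows≡ (fn-nth f ρ f≡ i) (fn-nth f ρ f≡ j)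

        edge≡ : ∀ i j → ⟦ edgeF H rows f i j ⟧ ρ ≡
          (if adj H i j then adj G (lookup x i) (lookup x j) else not (adj G (lookup x i) (lookup x j)))
        edge≡ i j with adj H i j
        ... | true  = adj≡ i j
        ... | false = trans (⟦not⟧ (adjF rows (nthF f i) (nthF f j)) ρ) (cong not (adj≡ i j))

        distinct≡ : ∀ i j → ⟦ distinctF H rows f i j ⟧ ρ ≡ sameVertex i j ∨ not (sameVertex (lookup x i) (lookup x j))
        distinct≡ i j with sameVertex i j
        ... | true  = refl
        ... | false = trans (⟦not⟧ (sameF (nthF f i) (nthF f j)) ρ)
          (cong not (⟦same⟧ (nthF f i) (nthF f j) ρ (fn-nth f ρ f≡ i) (fn-nth f ρ f≡ j)))

opaque
  countF : ∀ {k} → Fun k → Fun k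
  countF l = foldrF l nilF (nilF ∙F # 1F) (K 2 , λ y s e → ≤-reflexive (+-comm 2 (size s)))

  fn-count : ∀ {k} (l : Fun k) ρ → fn (countF l) ρ ≡ unary (length (elems (fn l ρ)))
  fn-count l ρ = go (elems (fn l ρ))
    where
    go : ∀ (xs : List Tree) → foldr (λ _ s → nil ∙ s) nil xs ≡ unary (length xs)
    go []       = refl
    go (x ∷ xs) = cong (nil ∙_) (go xs)

size-dropᵀ : ∀ j t → size (dropᵀ j t) ≤ size t
size-dropᵀ zero    t = ≤-refl
size-dropᵀ (suc j) t = ≤-trans (size-dropᵀ j (tlᵀ t)) (size-tl t)

ascending : ℕ → ℕ → Tree
ascending a zero    = nil
ascending a (suc j) = unary a ∙ ascending (suc a) j

length-ascending : ∀ a j → length (elems (ascending a j)) ≡ j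
length-ascending a zero    = refl
length-ascending a (suc j) = cong suc (length-ascending (suc a) j)

ascending-tabulate : ∀ a n → encodeList (tabulate {n = n} (λ i → unary (a + toℕ i))) ≡ ascending a n
ascending-tabulate a zero    = refl
ascending-tabulate a (suc n) = cong₂ _∙_ (cong unary (+-identityʳ a))
  (trans (cong encodeList (tabulate-cong (λ i → cong unary (+-suc a (toℕ i))))) (ascending-tabulate (suc a) n))

opaque
  -- The list built so far also serves as a counter: when it has j elements,
  -- the next one is n − 1 − j.
  verticesF : ∀ {k} → Fun k → Fin k → Fun k
  verticesF {k} rows i = foldrF rows nilF (dropF (# 1F) (tlF (# (suc (suc i)))) ∙F # 1F) (K 1 ⊕ X , growth)
    where
    growth : ∀ y s e → suc (size (fn (dropF (# 1F) (tlF (# (suc (suc i))))) (y ∷ s ∷ toVec k e)) + size s)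
                     ≤ size s + suc (size y + size e)
    growth y s e rewrite fn-drop (# 1F) (tlF (# (suc (suc i)))) (y ∷ s ∷ toVec k e) = begin
      suc (size (dropᵀ j (tlᵀ (lookup (toVec k e) i))) + size s) ≤⟨ s≤s (+-monoˡ-≤ (size s)
                                     (≤-trans (size-dropᵀ j _) (≤-trans (size-tl (lookup (toVec k e) i)) (size-lookup k e i)))) ⟩
      suc (size e + size s)          ≡⟨ +-comm (suc (size e)) (size s) ⟩
      size s + suc (size e)          ≤⟨ +-monoʳ-≤ (size s) (s≤s (m≤n+m (size e) (size y))) ⟩
      size s + suc (size y + size e) ∎
      where
      open ≤-Reasoning
      j : ℕ
      j = length (elems s)

  fn-vertices : ∀ {k} (rows : Fun k) i ρ {n} → length (elems (fn rows ρ)) ≡ n → lookup ρ i ≡ unary n →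
                fn (verticesF rows i) ρ ≡ list vertex (allFin n)
  fn-vertices {k} rows i ρ {n} len≡ i≡ = trans (go (elems (fn rows ρ)) (≤-reflexive len≡))
    (trans (cong₂ ascending (trans (cong (n ∸_) len≡) (n∸n≡0 n)) len≡)
      (trans (sym (ascending-tabulate 0 n)) (cong encodeList (sym (map-tabulate id vertex)))))
    where
    body : Tree → Tree → Tree
    body y s = fn (dropF (# 1F) (tlF (# (suc (suc i)))) ∙F # 1F) (y ∷ s ∷ ρ)

    go : ∀ xs → length xs ≤ n → foldr body nil xs ≡ ascending (n ∸ length xs) (length xs)
    go []       _   = refl
    go (x ∷ xs) j<n rewrite go xs (<⇒≤ j<n) = cong₂ _∙_
      (trans (fn-drop (# 1F) (tlF (# (suc (suc i)))) (x ∷ s ∷ ρ))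
        (trans (cong₂ dropᵀ (length-ascending (n ∸ j) j) (trans (cong tlᵀ i≡) (tl-unary n)))
          (trans (dropᵀ-unary j (n ∸ 1)) (cong unary (∸-+-assoc n 1 j)))))
      (cong (λ a → ascending a j) (sym (suc-∸ n j j<n)))
      where
      j : ℕ
      j = length xs
      s : Tree
      s = ascending (n ∸ j) j
      tl-unary : ∀ n → tlᵀ (unary n) ≡ unary (n ∸ 1)
      tl-unary zero    = refl
      tl-unary (suc n) = refl
      suc-∸ : ∀ n j → suc j ≤ n → suc (n ∸ suc j) ≡ n ∸ j
      suc-∸ (suc n) zero    _         = refl
      suc-∸ (suc n) (suc j) (s≤s j<n) = suc-∸ n j j<n

tuples : ∀ n m → List (Vec (Fin n) m)
tuples n zero    = [ [] ]
tuples n (suc m) = concatMap (λ a → concatMap (λ as → [ a ∷ as ]) (tuples n m)) (allFin n)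

opaque
  -- The recursion on the number of entries takes place while the program is built, and this is how
  -- the degree of the time bound comes to depend on `H`.
  tuplesF : ∀ {k} → ℕ → Fin k → Fun k
  tuplesF zero    i = nilF ∙F nilF
  tuplesF (suc m) i = letF (tuplesF m i)
    (concatMapF (# (suc i)) (concatMapF (# 1F) ((# 1F ∙F # 0F) ∙F nilF)))

  fn-tuples : ∀ {k n} m (i : Fin k) ρ → lookup ρ i ≡ list vertex (allFin n) →
              fn (tuplesF m i) ρ ≡ list tuple (tuples n m)
  fn-tuples zero    i ρ i≡ = refl
  fn-tuples {n = n} (suc m) i ρ i≡ rewrite i≡ | fn-tuples m i ρ i≡ =
    concatMapᵀ-list vertex tuple (λ a → concatMapᵀ-list tuple tuple (λ as → refl) (tuples n m)) (allFin n)

size-unary : ∀ t {j} → j ≤ length (elems t) → size (unary j) ≤ size t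
size-unary t       {zero}  _         = size≥1 t
size-unary (s ∙ t) {suc j} (s≤s j≤) = s≤s (+-mono-≤ (size≥1 s) (size-unary t j≤))

opaque
  -- The state consists of half the number of elements seen, rounded down and rounded up. One more
  -- element swaps the two and increments the second. The growth by 4 is attained at the state
  -- `nil`.
  halveF : ∀ {k} → Fun k → Fun k
  halveF l = hdF (foldrF l (nilF ∙F nilF) (tlF (# 1F) ∙F nilF ∙F hdF (# 1F)) (K 4 , λ y s e → growth s))
    where
    growth : ∀ s → suc (size (tlᵀ s) + suc (1 + size (hdᵀ s))) ≤ size s + 4
    growth nil     = ≤-refl
    growth (a ∙ b) = begin
      suc (size b + suc (1 + size a))   ≡⟨ cong suc (+-comm (size b) _) ⟩
      suc (2 + size a + size b)         ≡⟨ +-comm 2 (suc (size a + size b)) ⟩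
      suc (size a + size b) + 2         ≤⟨ +-monoʳ-≤ (suc (size a + size b)) (s≤s (s≤s z≤n)) ⟩
      suc (size a + size b) + 4         ∎
      where open ≤-Reasoning

  fn-halve : ∀ {k} (l : Fun k) ρ → fn (halveF l) ρ ≡ unary ⌊ length (elems (fn l ρ)) /2⌋
  fn-halve l ρ = cong hdᵀ (go (elems (fn l ρ)))
    where
    go : ∀ (xs : List Tree) → foldr (λ _ s → tlᵀ s ∙ nil ∙ hdᵀ s) (nil ∙ nil) xs ≡ unary ⌊ length xs /2⌋ ∙ unary ⌈ length xs /2⌉
    go []       = refl
    go (x ∷ xs) rewrite go xs = refl

  -- Decides k < N for N in unary and k in bijective base 2: N exceeds 1 + 2x
  -- iff ⌊N/2⌋ exceeds x, and 2 + 2x iff ⌊(N ∸ 1)/2⌋ does.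
  exceedsF : ∀ {k} → Fun k → Fun k → Fun k
  exceedsF {k} l digits = foldlF digits l (ifF (# 0F) (halveF (# 1F)) (halveF (tlF (# 1F)))) (K 0 , growth)
    where
    growth : ∀ y s e → size (if truthy y then fn (halveF (# 1F)) (y ∷ s ∷ toVec k e)
                             else fn (halveF (tlF (# 1F))) (y ∷ s ∷ toVec k e)) ≤ size s + 0
    growth y s e = m≤n⇒m≤n+o 0 (halved y)
      where
      halved : ∀ y → size (if truthy y then fn (halveF (# 1F)) (y ∷ s ∷ toVec k e)
                      else fn (halveF (tlF (# 1F))) (y ∷ s ∷ toVec k e)) ≤ size s
      halved nil     rewrite fn-halve (tlF (# 1F)) (nil ∷ s ∷ toVec k e) =
        ≤-trans (size-unary (tlᵀ s) (⌊n/2⌋≤n (length (elems (tlᵀ s))))) (size-tl s)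
      halved y@(_ ∙ _) rewrite fn-halve (# 1F) (y ∷ s ∷ toVec k e) = size-unary s (⌊n/2⌋≤n (length (elems s)))

  ⟦exceeds⟧ : ∀ {k} (l digits : Fun k) ρ x → fn digits ρ ≡ encodeℕᵇ x →
              ⟦ exceedsF l digits ⟧ ρ ≡ (ℕᵇ.toℕ x <ᵇ length (elems (fn l ρ)))
  ⟦exceeds⟧ l digits ρ x d≡ rewrite d≡ = go x (fn l ρ)
    where
    step : Tree → Tree → Tree
    step s y = fn (ifF (# 0F) (halveF (# 1F)) (halveF (tlF (# 1F)))) (y ∷ s ∷ ρ)

    length-tl : ∀ t → length (elems (tlᵀ t)) ≡ length (elems t) ∸ 1
    length-tl nil     = refl
    length-tl (s ∙ t) = refl

    half-< : ∀ a n → (a <ᵇ ⌊ n /2⌋) ≡ (suc (2 * a) <ᵇ n)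
    half-< a zero          = refl
    half-< a (suc zero)    = refl
    half-< zero (suc (suc n)) = refl
    half-< (suc a) (suc (suc n)) = trans (half-< a n) (cong (λ b → b <ᵇ n) (sym (+-suc a (a + 0))))

    truthy⇔nonempty : ∀ t → truthy t ≡ (0 <ᵇ length (elems t))
    truthy⇔nonempty nil     = refl
    truthy⇔nonempty (s ∙ t) = refl

    half-pred-< : ∀ a n → (a <ᵇ ⌊ n ∸ 1 /2⌋) ≡ (2 * suc a <ᵇ n)
    half-pred-< a zero    = refl
    half-pred-< a (suc n) = trans (half-< a n) (cong (λ b → b <ᵇ n) (sym (+-suc a (a + 0))))

    go : ∀ x t → truthy (foldl step t (elems (encodeℕᵇ x))) ≡ (ℕᵇ.toℕ x <ᵇ length (elems t))
    go ℕᵇ.zero   t = truthy⇔nonempty t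
    go 2[1+ x ] t rewrite fn-halve (tlF (# 1F)) (nil ∷ t ∷ ρ) = trans (go x _)
      (trans (cong (ℕᵇ.toℕ x <ᵇ_) (trans (length-unary ⌊ length (elems (tlᵀ t)) /2⌋) (cong ⌊_/2⌋ (length-tl t))))
        (half-pred-< (ℕᵇ.toℕ x) (length (elems t))))
    go 1+[2 x ] t rewrite fn-halve (# 1F) ((nil ∙ nil) ∷ t ∷ ρ) = trans (go x _)
      (trans (cong (ℕᵇ.toℕ x <ᵇ_) (length-unary ⌊ length (elems t) /2⌋)) (half-< (ℕᵇ.toℕ x) (length (elems t))))

size-if : ∀ b {t u a} → size t ≤ a → size u ≤ a → size (if b then t else u) ≤ a
size-if true  t≤ u≤ = t≤
size-if false t≤ u≤ = u≤

-- The decision procedure and its program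

module Decision {m n : ℕ} (H : Graph m) (G : Graph n) where
  open Tuples m
  open Algorithm {Vec (Fin n) m} sameTuple (conflict G) public

  embeddings : List (Vec (Fin n) m)
  embeddings = filterᵇ (isEmbedding H G) (tuples n m)

  compatible : Vec (Fin n) m → List (Vec (Fin n) m)
  compatible s = filterᵇ (λ x → not (conflict G s x)) embeddings

  -- For `k = 0` there may be no member at which to cut, but the empty matching always exists.
  decide : ℕ → Bool
  decide k = if 0 <ᵇ k then any (λ s → k <ᵇ length (layers (allFin n) (compatible s))) embeddings else true

module Main {m : ℕ} (H : Graph m) where
  open Tuples m

  -- The comments list the variables of the context, innermost first; _ is
  -- the unused counter of a loop, and an ellipsis stands for the variables
  -- compatible, s, embeddings, rows, input.

  -- rows, input
  embeddingsF : Fun 2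
  embeddingsF = letF (countF (# 0F)) (letF (verticesF (# 1F) 0F)
    (filterF (tuplesF m 0F) (isEmbeddingF H (# 3F) (# 0F))))

  -- s, embeddings, rows, input
  compatibleF : Fun 4
  compatibleF = filterF (# 1F) (notF (conflictF (# 1F) (# 0F) (# 3F)))

  -- x, ...
  edgesFromF : Fun 6
  edgesFromF = concatMapF (# 1F) (ifF (conflictF (# 1F) (# 0F) (# 5F)) nilF ((# 1F ∙F # 0F) ∙F nilF))

  -- ...
  edgesF : Fun 5
  edgesF = concatMapF (# 0F) edgesFromF

  module _ {k : ℕ} where
    opaque
      ΓF : Fun k → Fun k → Fun k → Fun k
      ΓF rows e f = (sameTupleF (hdF e) (hdF f) ∧F conflictF (tlF e) (tlF f) rows)
                 ∨F (sameTupleF (tlF e) (tlF f) ∧F conflictF (hdF e) (hdF f) rows)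

      ⟦Γ⟧ : ∀ {n} (G : Graph n) rows e f ρ → fn rows ρ ≡ encodeGraph G → ∀ {p q} →
            fn e ρ ≡ pairᵀ p → fn f ρ ≡ pairᵀ q → ⟦ ΓF rows e f ⟧ ρ ≡ Decision.Γ H G p q
      ⟦Γ⟧ G rows e f ρ r≡ e≡ f≡ = trans
        (⟦∨⟧ (sameTupleF (hdF e) (hdF f) ∧F conflictF (tlF e) (tlF f) rows)
             (sameTupleF (tlF e) (tlF f) ∧F conflictF (hdF e) (hdF f) rows) ρ)
        (cong₂ _∨_
          (trans (⟦∧⟧ (sameTupleF (hdF e) (hdF f)) (conflictF (tlF e) (tlF f) rows) ρ) (cong₂ _∧_
            (⟦sameTuple⟧ (hdF e) (hdF f) ρ (cong hdᵀ e≡) (cong hdᵀ f≡))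
            (⟦conflict⟧ G rows ρ r≡ (tlF e) (tlF f) (cong tlᵀ e≡) (cong tlᵀ f≡))))
          (trans (⟦∧⟧ (sameTupleF (tlF e) (tlF f)) (conflictF (hdF e) (hdF f) rows) ρ) (cong₂ _∧_
            (⟦sameTuple⟧ (tlF e) (tlF f) ρ (cong tlᵀ e≡) (cong tlᵀ f≡))
            (⟦conflict⟧ G rows ρ r≡ (hdF e) (hdF f) (cong hdᵀ e≡) (cong hdᵀ f≡)))))

  -- t, _, R, e, O, U, ...
  reachedF : Fun 11
  reachedF = filterF (# 2F) (ΓF (# (suc 9F)) (# 0F) (# 1F))

  -- _, R, e, O, U, ...
  growF : Fun 10
  growF = filterF (# 4F) reachedF

  -- The bound is the size of `U` and does not involve the set `R` from the previous round, so that
  -- it survives the iteration.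
  size-grow : ∀ ρ → size (fn growF ρ) ≤ size (lookup ρ 4F)
  size-grow ρ = size-filterᵀ (λ t → ⟦ reachedF ⟧ (t ∷ ρ)) (lookup ρ 4F)

  growF-growth : Growth growF
  growF-growth = X , λ y s e → m≤n⇒m≤o+n (size s)
    (≤-trans (size-grow (y ∷ s ∷ toVec 8 e)) (m≤n⇒m≤o+n (size y) (size-lookup 8 e 2F)))

  -- e, O, U, ...
  startF classF : Fun 8
  startF = filterF (# 2F) (ΓF (# 7F) (# 1F) (# 0F))
  classF = foldrF (# 2F) startF growF growF-growth

  size-class : ∀ ρ → size (fn classF ρ) ≤ size (lookup ρ 2F)
  size-class ρ = size-foldr (elems (lookup ρ 2F))
    (size-filterᵀ (λ t → ⟦ ΓF (# 7F) (# 1F) (# 0F) ⟧ (t ∷ ρ)) (lookup ρ 2F))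
    (λ y s _ → size-grow (y ∷ s ∷ ρ))

  -- e, O, U, ...
  orientedF swappedF extendF : Fun 8
  orientedF = filterF (# 1F) (ΓF (# 7F) (# 0F) (# 1F))
  swappedF  = filterF (# 1F) (ΓF (# 7F) (# 0F) (tlF (# 1F) ∙F hdF (# 1F)))
  extendF   = ifF (orientedF ∨F swappedF) (# 1F) (classF ++F # 1F)

  extendF-growth : Growth extendF
  extendF-growth = X , λ y s e → size-if (⟦ orientedF ∨F swappedF ⟧ (y ∷ s ∷ toVec 6 e))
    (m≤m+n (size s) (size y + size e))
    (≤-trans (size-++ᵀ (fn classF (y ∷ s ∷ toVec 6 e)) s) (+-monoʳ-≤ (size s)
      (≤-trans (size-class (y ∷ s ∷ toVec 6 e)) (m≤n⇒m≤o+n (size y) (size-lookup 6 e 0F)))))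

  -- U, ...
  orientF : Fun 6
  orientF = foldrF (# 0F) nilF extendF extendF-growth

  -- x, y, _, layers, O, U, ...
  apartF beforeF followsF : Fun 11
  apartF   = notF (conflictF (# 0F) (# 1F) (# 9F))
  beforeF  = filterF (# 4F) (ΓF (# (suc 9F)) (# 0F) (# 1F ∙F # 2F))
  followsF = apartF ∧F beforeF

  -- y, _, layers, O, U, ...
  nextBodyF : Fun 10
  nextBodyF = filterF (hdF (# 2F)) followsF

  -- _, layers, O, U, ...
  nextF pushF : Fun 9
  nextF = filterF (# 4F) nextBodyF
  pushF = ifF (hdF (# 1F)) (nextF ∙F # 1F) (# 1F)

  pushF-growth : Growth pushF
  pushF-growth = K 1 ⊕ X , λ y s e → size-if (truthy (hdᵀ s))
    (≤-trans (≤-reflexive (+-comm (suc (size (fn nextF (y ∷ s ∷ toVec 7 e)))) (size s)))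
      (+-monoʳ-≤ (size s) (s≤s (≤-trans (size-next (y ∷ s ∷ toVec 7 e)) (m≤n⇒m≤o+n (size y) (size-lookup 7 e 2F))))))
    (m≤m+n (size s) (suc (size y + size e)))
    where
    size-next : ∀ ρ → size (fn nextF ρ) ≤ size (lookup ρ 4F)
    size-next ρ = size-filterᵀ (λ y → ⟦ nextBodyF ⟧ (y ∷ ρ)) (lookup ρ 4F)

  -- O, U, ...
  layersF : Fun 7
  layersF = foldrF (# 5F) (# 2F ∙F nilF ∙F nilF) pushF pushF-growth

  -- s, embeddings, rows, input
  enoughF : Fun 4
  enoughF = letF compatibleF (letF edgesF (letF orientF (exceedsF layersF (tlF (# 6F)))))

  -- input
  decideF : Fun 1
  decideF = letF (hdF (# 0F)) (letF embeddingsF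
    (ifF (ifF (tlF (# 2F)) (filterF (# 0F) enoughF) trueF) trueF nilF))

  module _ {n} (G : Graph n) (k : ℕ) where
    open Decision H G

    rowsᵀ input : Tree
    rowsᵀ = encodeGraph G
    input = encode G k

    fn-embeddings : fn embeddingsF (rowsᵀ ∷ input ∷ []) ≡ list tuple embeddings
    fn-embeddings = filterF-list tuple (tuplesF m 0F) (isEmbeddingF H (# 3F) (# 0F))
      (verticesᵀ ∷ countᵀ ∷ rowsᵀ ∷ input ∷ [])
      (fn-tuples m 0F (verticesᵀ ∷ countᵀ ∷ rowsᵀ ∷ input ∷ []) vertices≡)
      (λ x → ⟦isEmbedding⟧ G (# 3F) (tuple x ∷ verticesᵀ ∷ countᵀ ∷ rowsᵀ ∷ input ∷ []) refl H (# 0F) refl)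
      where
      countᵀ verticesᵀ : Tree
      countᵀ    = fn (countF (# 0F)) (rowsᵀ ∷ input ∷ [])
      verticesᵀ = fn (verticesF (# 1F) 0F) (countᵀ ∷ rowsᵀ ∷ input ∷ [])

      row : Fin n → Tree
      row a = encodeList (tabulate λ b → encodeBool (adj G a b))

      elems-encodeList : ∀ xs → elems (encodeList xs) ≡ xs
      elems-encodeList []       = refl
      elems-encodeList (x ∷ xs) = cong (x ∷_) (elems-encodeList xs)

      length-rows : length (elems rowsᵀ) ≡ n
      length-rows = trans (cong length (elems-encodeList (tabulate row))) (length-tabulate row)

      vertices≡ : verticesᵀ ≡ list vertex (allFin n)
      vertices≡ = fn-vertices (# 1F) 0F (countᵀ ∷ rowsᵀ ∷ input ∷ []) length-rows
        (trans (fn-count (# 0F) (rowsᵀ ∷ input ∷ [])) (cong unary length-rows))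

    module _ (s : Vec (Fin n) m) where

      ρ : Vec Tree 4
      ρ = tuple s ∷ list tuple embeddings ∷ rowsᵀ ∷ input ∷ []

      fn-compatible : fn compatibleF ρ ≡ list tuple (compatible s)
      fn-compatible = filterF-list tuple (# 1F) (notF (conflictF (# 1F) (# 0F) (# 3F))) ρ refl
        (λ x → trans (⟦not⟧ (conflictF (# 1F) (# 0F) (# 3F)) (tuple x ∷ ρ))
          (cong not (⟦conflict⟧ G (# 3F) (tuple x ∷ ρ) refl (# 1F) (# 0F) refl refl)))

      module _ (W : List (Vec (Fin n) m)) where

        fn-edges : fn edgesF (list tuple W ∷ ρ) ≡ list pairᵀ (edges W)
        fn-edges = concatMapᵀ-list tuple pairᵀ (λ x → concatMapᵀ-list tuple pairᵀ (λ y → edge x y) W) W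
          where
          edge : ∀ x y → fn (ifF (conflictF (# 1F) (# 0F) (# 5F)) nilF ((# 1F ∙F # 0F) ∙F nilF))
                           (tuple y ∷ tuple x ∷ list tuple W ∷ ρ)
                       ≡ list pairᵀ (if conflict G x y then [] else [ x , y ])
          edge x y = trans
            (cong (λ b → if b then nil else ((tuple x ∙ tuple y) ∙ nil))
              (⟦conflict⟧ G (# 5F) (tuple y ∷ tuple x ∷ list tuple W ∷ ρ) refl (# 1F) (# 0F) {x} {y} refl refl))
            (branches (conflict G x y))
            where
            branches : ∀ b → (if b then nil else ((tuple x ∙ tuple y) ∙ nil)) ≡ list pairᵀ (if b then [] else [ x , y ])
            branches true  = refl
            branches false = refl

        module _ (U O : List (Vec (Fin n) m × Vec (Fin n) m)) (e : Vec (Fin n) m × Vec (Fin n) m) where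

          private
            σ : Vec Tree 8
            σ = pairᵀ e ∷ list pairᵀ O ∷ list pairᵀ U ∷ list tuple W ∷ ρ

          ⟦reached⟧ : ∀ (y : Tree) (R : List (Vec (Fin n) m × Vec (Fin n) m)) (t : Vec (Fin n) m × Vec (Fin n) m) →
                      ⟦ reachedF ⟧ (pairᵀ t ∷ y ∷ list pairᵀ R ∷ σ) ≡ any (λ r → Γ r t) R
          ⟦reached⟧ y R t = filterF-any pairᵀ (# 2F) (ΓF (# (suc 9F)) (# 0F) (# 1F)) τ {R} {λ r → Γ r t} refl
            (λ r → ⟦Γ⟧ G (# (suc 9F)) (# 0F) (# 1F) (pairᵀ r ∷ τ) refl {r} {t} refl refl)
            where
            τ : Vec Tree 11
            τ = pairᵀ t ∷ y ∷ list pairᵀ R ∷ σ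

          fn-grow : ∀ (y : Tree) R → fn growF (y ∷ list pairᵀ R ∷ σ) ≡ list pairᵀ (grow U R)
          fn-grow y R = filterF-list pairᵀ (# 4F) reachedF (y ∷ list pairᵀ R ∷ σ)
            {U} {λ t → any (λ r → Γ r t) R} refl (⟦reached⟧ y R)

          fn-start : fn startF σ ≡ list pairᵀ (filterᵇ (Γ e) U)
          fn-start = filterF-list pairᵀ (# 2F) (ΓF (# 7F) (# 1F) (# 0F)) σ {U} {Γ e} refl
            (λ t → ⟦Γ⟧ G (# 7F) (# 1F) (# 0F) (pairᵀ t ∷ σ) refl {e} {t} refl refl)

          fn-class : fn classF σ ≡ list pairᵀ (class U e)
          fn-class = foldr-list pairᵀ (list pairᵀ) {λ y R → fn growF (y ∷ R ∷ σ)} {λ _ R → grow U R}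
            {fn startF σ} {filterᵇ (Γ e) U} fn-start (λ y R → fn-grow (pairᵀ y) R) {list pairᵀ U} {U} refl

          ⟦extends⟧ : ⟦ orientedF ∨F swappedF ⟧ σ ≡ oriented O e ∨ oriented O (swap e)
          ⟦extends⟧ = trans (⟦∨⟧ orientedF swappedF σ) (cong₂ _∨_
            (filterF-any pairᵀ (# 1F) (ΓF (# 7F) (# 0F) (# 1F)) σ {O} {λ r → Γ r e} refl
              (λ r → ⟦Γ⟧ G (# 7F) (# 0F) (# 1F) (pairᵀ r ∷ σ) refl {r} {e} refl refl))
            (filterF-any pairᵀ (# 1F) (ΓF (# 7F) (# 0F) (tlF (# 1F) ∙F hdF (# 1F))) σ {O} {λ r → Γ r (swap e)} refl
              (λ r → ⟦Γ⟧ G (# 7F) (# 0F) (tlF (# 1F) ∙F hdF (# 1F)) (pairᵀ r ∷ σ) refl {r} {swap e} refl refl)))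

          fn-extend : fn extendF σ ≡ list pairᵀ (extend U e O)
          fn-extend = trans (cong (λ b → if b then list pairᵀ O else (fn classF σ ++ᵀ list pairᵀ O)) ⟦extends⟧)
            (branches (oriented O e ∨ oriented O (swap e)))
            where
            branches : ∀ b → (if b then list pairᵀ O else (fn classF σ ++ᵀ list pairᵀ O))
                           ≡ list pairᵀ (if b then O else class U e ++ O)
            branches true  = refl
            branches false = trans (cong (_++ᵀ list pairᵀ O) fn-class) (++ᵀ-list pairᵀ (class U e) O)

        fn-orient : ∀ U → fn orientF (list pairᵀ U ∷ list tuple W ∷ ρ) ≡ list pairᵀ (orient U)
        fn-orient U = foldr-list pairᵀ (list pairᵀ)
          {λ e O → fn extendF (e ∷ O ∷ list pairᵀ U ∷ list tuple W ∷ ρ)} {extend U} {nil} {[]} refl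
          (λ e O → fn-extend U O e) {list pairᵀ U} {U} refl

        module _ (O : List (Vec (Fin n) m × Vec (Fin n) m)) (a : Tree) where

          private
            τ : List (List (Vec (Fin n) m)) → Vec Tree 9
            τ s = a ∷ list (list tuple) s ∷ list pairᵀ O ∷ list pairᵀ (edges W) ∷ list tuple W ∷ ρ

          ⟦follows⟧ : ∀ s y x → ⟦ followsF ⟧ (tuple x ∷ tuple y ∷ τ s) ≡ not (conflict G x y) ∧ oriented O (x , y)
          ⟦follows⟧ s y x = trans (⟦∧⟧ apartF beforeF (tuple x ∷ tuple y ∷ τ s)) (cong₂ _∧_
            (trans (⟦not⟧ (conflictF (# 0F) (# 1F) (# 9F)) (tuple x ∷ tuple y ∷ τ s))
              (cong not (⟦conflict⟧ G (# 9F) (tuple x ∷ tuple y ∷ τ s) refl (# 0F) (# 1F) {x} {y} refl refl)))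
            (filterF-any pairᵀ (# 4F) (ΓF (# (suc 9F)) (# 0F) (# 1F ∙F # 2F)) (tuple x ∷ tuple y ∷ τ s)
              {O} {λ r → Γ r (x , y)} refl
              (λ r → ⟦Γ⟧ G (# (suc 9F)) (# 0F) (# 1F ∙F # 2F) (pairᵀ r ∷ tuple x ∷ tuple y ∷ τ s) refl {r} {x , y} refl refl)))

          fn-next : ∀ L s → fn nextF (τ (L ∷ s)) ≡ list tuple (next W O L)
          fn-next L s = filterF-list tuple (# 4F) nextBodyF (τ (L ∷ s)) {W} {λ y → any (λ x → not (conflict G x y) ∧ oriented O (x , y)) L} refl
            (λ y → filterF-any tuple (hdF (# 2F)) followsF (tuple y ∷ τ (L ∷ s)) {L} {λ x → not (conflict G x y) ∧ oriented O (x , y)} refl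
              (⟦follows⟧ (L ∷ s) y))

          fn-push : ∀ s → fn pushF (τ s) ≡ list (list tuple) (push W O s)
          fn-push []            = refl
          fn-push ([] ∷ s)      = refl
          fn-push ((x ∷ L) ∷ s) = cong (_∙ list (list tuple) ((x ∷ L) ∷ s)) (fn-next (x ∷ L) s)

        fn-layers : fn layersF (list pairᵀ (orient (edges W)) ∷ list pairᵀ (edges W) ∷ list tuple W ∷ ρ)
                  ≡ list (list tuple) (layers (allFin n) W)
        fn-layers = foldr-list row (list (list tuple)) {λ a s → fn pushF (a ∷ s ∷ σ)} {λ _ → push W O}
          {list tuple W ∙ nil ∙ nil} {W ∷ [] ∷ []} refl (λ a s → fn-push O (row a) s) {rowsᵀ} {allFin n}
          (cong encodeList (sym (map-tabulate id row)))
          where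
          row : Fin n → Tree
          row a = encodeList (tabulate λ b → encodeBool (adj G a b))

          O : List (Vec (Fin n) m × Vec (Fin n) m)
          O = orient (edges W)

          σ : Vec Tree 7
          σ = list pairᵀ O ∷ list pairᵀ (edges W) ∷ list tuple W ∷ ρ

      private
        W : List (Vec (Fin n) m)
        W = compatible s

      -- The computed trees are variables here, so that matching on the equations replaces them at
      -- every place of the context at once.
      fn-layers′ : ∀ {w u o} → w ≡ list tuple W → u ≡ list pairᵀ (edges W) → o ≡ list pairᵀ (orient (edges W)) →
                   fn layersF (o ∷ u ∷ w ∷ ρ) ≡ list (list tuple) (layers (allFin n) W)
      fn-layers′ refl refl refl = fn-layers W

      fn-edges′ : ∀ {w} → w ≡ list tuple W → fn edgesF (w ∷ ρ) ≡ list pairᵀ (edges W)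
      fn-edges′ refl = fn-edges W

      fn-orient′ : ∀ {w u} → w ≡ list tuple W → u ≡ list pairᵀ (edges W) →
                   fn orientF (u ∷ w ∷ ρ) ≡ list pairᵀ (orient (edges W))
      fn-orient′ refl refl = fn-orient W (edges W)

      ⟦enough⟧ : ⟦ enoughF ⟧ ρ ≡ (k <ᵇ length (layers (allFin n) W))
      ⟦enough⟧ = trans (⟦exceeds⟧ layersF (tlF (# 6F)) σ (ℕᵇ.fromℕ k) refl)
        (cong₂ _<ᵇ_ (ℕᵇ.toℕ-fromℕ k) (trans
          (cong (length ∘ elems) (fn-layers′ fn-compatible w≡ (fn-orient′ fn-compatible w≡)))
          (trans (cong length (elems-list (list tuple) (layers (allFin n) W))) (length-map (list tuple) (layers (allFin n) W)))))
        where
        wᵀ uᵀ oᵀ : Tree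
        wᵀ = fn compatibleF ρ
        uᵀ = fn edgesF (wᵀ ∷ ρ)
        oᵀ = fn orientF (uᵀ ∷ wᵀ ∷ ρ)

        w≡ : uᵀ ≡ list pairᵀ (edges W)
        w≡ = fn-edges′ fn-compatible

        σ : Vec Tree 7
        σ = oᵀ ∷ uᵀ ∷ wᵀ ∷ ρ

    ⟦k⟧ : truthy (encodeℕᵇ (ℕᵇ.fromℕ k)) ≡ (0 <ᵇ k)
    ⟦k⟧ = trans (positive (ℕᵇ.fromℕ k)) (cong (0 <ᵇ_) (ℕᵇ.toℕ-fromℕ k))
      where
      positive : ∀ x → truthy (encodeℕᵇ x) ≡ (0 <ᵇ ℕᵇ.toℕ x)
      positive ℕᵇ.zero  = refl
      positive 2[1+ x ] = refl
      positive 1+[2 x ] = refl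

    fn-decide : fn decideF (input ∷ []) ≡ encodeBool (decide k)
    fn-decide = trans (cong (λ b → if b then nil ∙ nil else nil) (decided fn-embeddings)) (normal (decide k))
      where
      normal : ∀ b → (if b then nil ∙ nil else nil) ≡ encodeBool b
      normal true  = refl
      normal false = refl

      answerF : Fun 3
      answerF = ifF (tlF (# 2F)) (filterF (# 0F) enoughF) trueF

      decided : ∀ {e} → e ≡ list tuple embeddings → ⟦ answerF ⟧ (e ∷ rowsᵀ ∷ input ∷ []) ≡ decide k
      decided refl = branches ⟦k⟧
        where
        branches : ∀ {b c} → b ≡ c →
          truthy (if b then fn (filterF (# 0F) enoughF) (list tuple embeddings ∷ rowsᵀ ∷ input ∷ []) else (nil ∙ nil))
          ≡ (if c then any (λ s → k <ᵇ length (layers (allFin n) (compatible s))) embeddings else true)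
        branches {true}  refl = filterF-any tuple (# 0F) enoughF (list tuple embeddings ∷ rowsᵀ ∷ input ∷ []) refl ⟦enough⟧
        branches {false} refl = refl

-- Boolean tests on lists

module _ {A : Set} {p : A → Bool} where

  any-intro : ∀ {x xs} → x ∈ xs → T (p x) → T (any p xs)
  any-intro x∈xs px = any⁺ p (lose x∈xs px)

  any-elim : ∀ {xs} → T (any p xs) → ∃[ x ] (x ∈ xs × T (p x))
  any-elim {xs} h = find (any⁻ p xs h)

  filterᵇ-intro : ∀ {x xs} → x ∈ xs → T (p x) → x ∈ filterᵇ p xs
  filterᵇ-intro = ∈-filter⁺ (T? ∘ p)

  filterᵇ-elim : ∀ {x xs} → x ∈ filterᵇ p xs → x ∈ xs × T (p x)
  filterᵇ-elim = ∈-filter⁻ (T? ∘ p)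

T-not-intro : ∀ {b} → ¬ T b → T (not b)
T-not-intro {false} _  = _
T-not-intro {true}  ¬b = ¬b _

T-not-elim : ∀ {b} → T (not b) → ¬ T b
T-not-elim {false} _ ()

concatMap-intro : ∀ {A B : Set} {f : A → List B} {x y xs} → x ∈ xs → y ∈ f x → y ∈ concatMap f xs
concatMap-intro {f = f} x∈ y∈ = ∈-concatMap⁺ f (lose x∈ y∈)

concatMap-elim : ∀ {A B : Set} {f : A → List B} {y} xs → y ∈ concatMap f xs → ∃[ x ] (x ∈ xs × y ∈ f x)
concatMap-elim {f = f} xs y∈ = find (∈-concatMap⁻ f {xs = xs} y∈)

filterᵇ-⊆-length : ∀ {A : Set} {p q : A → Bool} xs → (∀ {x} → x ∈ xs → T (p x) → T (q x)) →
                   length (filterᵇ p xs) ≤ length (filterᵇ q xs)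
filterᵇ-⊆-length [] p⊆q = z≤n
filterᵇ-⊆-length {p = p} {q} (x ∷ xs) p⊆q with p x | q x | p⊆q (here refl)
... | true  | true  | _ = s≤s (filterᵇ-⊆-length xs (p⊆q ∘ there))
... | true  | false | h = ⊥-elim (h _)
... | false | true  | _ = m≤n⇒m≤1+n (filterᵇ-⊆-length xs (p⊆q ∘ there))
... | false | false | _ = filterᵇ-⊆-length xs (p⊆q ∘ there)

-- Lets a mere comparison of lengths certify that a round of `grow` has changed nothing.
filterᵇ-⊆-stable : ∀ {A : Set} {p q : A → Bool} xs → (∀ {x} → x ∈ xs → T (p x) → T (q x)) →
                   length (filterᵇ q xs) ≤ length (filterᵇ p xs) → filterᵇ q xs ≡ filterᵇ p xs
filterᵇ-⊆-stable [] p⊆q _ = refl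
filterᵇ-⊆-stable {p = p} {q} (x ∷ xs) p⊆q h with p x | q x | p⊆q (here refl)
... | true  | true  | _ = cong (x ∷_) (filterᵇ-⊆-stable xs (p⊆q ∘ there) (s≤s⁻¹ h))
... | true  | false | i = ⊥-elim (i _)
... | false | true  | _ = ⊥-elim (1+n≰n (≤-trans h (filterᵇ-⊆-length xs (p⊆q ∘ there))))
... | false | false | _ = filterᵇ-⊆-stable xs (p⊆q ∘ there) h

-- Compares two vertices in the order of processing, where the list behind a vertex holds those
-- processed before it.
shorter-suffix : ∀ {A : Set} pre {u : A} {ws} pre′ {u′ ws′} → pre ++ u ∷ ws ≡ pre′ ++ u′ ∷ ws′ →
                 length ws ≤ length ws′ → u ≡ u′ ⊎ u ∈ ws′
shorter-suffix []        []         eq le = inj₁ (proj₁ (∷-injective eq))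
shorter-suffix []        (x ∷ pre′) {u′} {ws′} refl le = ⊥-elim (go pre′ le)
  where
  go : ∀ ys → ¬ (length (ys ++ u′ ∷ ws′) ≤ length ws′)
  go []       h = 1+n≰n h
  go (y ∷ ys) h = go ys (<⇒≤ h)
shorter-suffix (x ∷ pre) []         refl le = inj₂ (∈-++⁺ʳ pre (here refl))
shorter-suffix (x ∷ pre) (y ∷ pre′) eq   le = shorter-suffix pre pre′ (proj₂ (∷-injective eq)) le

-- The lexicographic orientation

module Orientation {A : Set} (same conf : A → A → Bool)
  (same⇒≡ : ∀ {x y} → T (same x y) → x ≡ y) (same-refl : ∀ x → T (same x x))
  (conf-refl : ∀ x → T (conf x x)) (conf-sym : ∀ {x y} → T (conf x y) → T (conf y x))
  (W : List A) where

  open Algorithm same conf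

  U : List (A × A)
  U = edges W

  infix 4 _⟶_ _⟶*_

  -- Golumbic's forcing relation on the complement of the conflict graph; the classes of its closure
  -- `_⟶*_` are the implication classes.
  record _⟶_ (e f : A × A) : Set where
    constructor step
    field
      source : e ∈ U
      target : f ∈ U
      forced : T (Γ e f)

  _⟶*_ : A × A → A × A → Set
  _⟶*_ = Star _⟶_

  edge-intro : ∀ {x y} → x ∈ W → y ∈ W → ¬ T (conf x y) → (x , y) ∈ U
  edge-intro {x} {y} x∈ y∈ ¬c = concatMap-intro x∈ (concatMap-intro y∈ (singleton (conf x y) ¬c))
    where
    singleton : ∀ b → ¬ T b → (x , y) ∈ (if b then [] else [ x , y ])
    singleton true  ¬b = ⊥-elim (¬b _)
    singleton false _  = here refl

  edge-elim : ∀ {x y} → (x , y) ∈ U → x ∈ W × y ∈ W × ¬ T (conf x y)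
  edge-elim {x} {y} e∈ with concatMap-elim W e∈
  ... | x′ , x′∈ , e∈′ with concatMap-elim W e∈′
  ...   | y′ , y′∈ , e∈″ with conf x′ y′ in eq | e∈″
  ...     | false | here refl = x′∈ , y′∈ , λ c → subst T eq c

  edge-swap : ∀ {e} → e ∈ U → swap e ∈ U
  edge-swap e∈ = let x∈ , y∈ , ¬c = edge-elim e∈ in edge-intro y∈ x∈ (¬c ∘ conf-sym)

  forced-elim : ∀ {x y x′ y′} → T (Γ (x , y) (x′ , y′)) →
                (x ≡ x′ × T (conf y y′)) ⊎ (y ≡ y′ × T (conf x x′))
  forced-elim h with Equivalence.to T-∨ h
  ... | inj₁ h₁ = let s , c = Equivalence.to T-∧ h₁ in inj₁ (same⇒≡ s , c)
  ... | inj₂ h₂ = let s , c = Equivalence.to T-∧ h₂ in inj₂ (same⇒≡ s , c)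

  forced-right : ∀ {x y y′} → T (conf y y′) → T (Γ (x , y) (x , y′))
  forced-right {x} c = Equivalence.from T-∨ (inj₁ (Equivalence.from T-∧ (same-refl x , c)))

  forced-left : ∀ {x x′ y} → T (conf x x′) → T (Γ (x , y) (x′ , y))
  forced-left {x} {x′} {y} c = Equivalence.from (T-∨ {x = same x x′ ∧ conf y y})
    (inj₂ (Equivalence.from T-∧ (same-refl y , c)))

  ⟶-refl : ∀ {e} → e ∈ U → e ⟶ e
  ⟶-refl {x , y} e∈ = step e∈ e∈ (forced-right (conf-refl y))

  ⟶-sym : ∀ {e f} → e ⟶ f → f ⟶ e
  ⟶-sym (step e∈ f∈ h) with forced-elim h
  ... | inj₁ (refl , c) = step f∈ e∈ (forced-right (conf-sym c))
  ... | inj₂ (refl , c) = step f∈ e∈ (forced-left (conf-sym c))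

  ⟶-swap : ∀ {e f} → e ⟶ f → swap e ⟶ swap f
  ⟶-swap (step e∈ f∈ h) with forced-elim h
  ... | inj₁ (refl , c) = step (edge-swap e∈) (edge-swap f∈) (forced-left c)
  ... | inj₂ (refl , c) = step (edge-swap e∈) (edge-swap f∈) (forced-right c)

  ⟶*-sym : ∀ {e f} → e ⟶* f → f ⟶* e
  ⟶*-sym = reverseStar ⟶-sym

  ⟶*-swap : ∀ {e f} → e ⟶* f → swap e ⟶* swap f
  ⟶*-swap = gmap swap ⟶-swap

  ⟶*-edge : ∀ {e f} → e ∈ U → e ⟶* f → f ∈ U
  ⟶*-edge e∈ ε        = e∈
  ⟶*-edge e∈ (s ◅ ss) = ⟶*-edge (_⟶_.target s) ss

  Closed : List (A × A) → Set
  Closed O = ∀ {e f} → e ∈ O → e ⟶ f → f ∈ O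

  Closed* : ∀ {O} → Closed O → ∀ {e f} → e ∈ O → e ⟶* f → f ∈ O
  Closed* cl e∈ ε        = e∈
  Closed* cl e∈ (s ◅ ss) = Closed* cl (cl e∈ s) ss

  grow-intro : ∀ {R r t} → r ∈ R → r ⟶ t → t ∈ grow U R
  grow-intro r∈ (step _ t∈ h) = filterᵇ-intro t∈ (any-intro r∈ h)

  module _ {e : A × A} (e∈U : e ∈ U) where

    private
      iterate : List (A × A) → List (A × A)
      iterate = foldr (λ _ R → grow U R) (filterᵇ (Γ e) U)

      iterate-sound : ∀ xs {t} → t ∈ iterate xs → e ⟶* t
      iterate-sound []       t∈ = let t∈U , h = filterᵇ-elim t∈ in step e∈U t∈U h ◅ ε
      iterate-sound (_ ∷ xs) t∈ =
        let t∈U , h   = filterᵇ-elim {p = λ t → any (λ r → Γ r t) (iterate xs)} {xs = U} t∈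
            r , r∈ , g = any-elim {xs = iterate xs} h
            e⟶*r      = iterate-sound xs r∈
        in  e⟶*r ◅◅ (step (⟶*-edge e∈U e⟶*r) t∈U g ◅ ε)

      iterate-self : ∀ xs → e ∈ iterate xs
      iterate-self []       = filterᵇ-intro e∈U (_⟶_.forced (⟶-refl e∈U))
      iterate-self (_ ∷ xs) = grow-intro (iterate-self xs) (⟶-refl e∈U)

      -- Presents the initial set, too, as a selection from `U`, so that any two consecutive stages
      -- can be compared by their lengths.
      test : List (A × A) → A × A → Bool
      test []       t = Γ e t
      test (_ ∷ xs) t = any (λ r → Γ r t) (iterate xs)

      iterate-filter : ∀ xs → iterate xs ≡ filterᵇ (test xs) U
      iterate-filter []       = refl
      iterate-filter (_ ∷ xs) = refl

      iterate-grows : ∀ xs {t} → t ∈ U → T (test xs t) → T (any (λ r → Γ r t) (iterate xs))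
      iterate-grows xs {t} t∈ h = any-intro (subst (t ∈_) (sym (iterate-filter xs)) (filterᵇ-intro t∈ h))
                                    (_⟶_.forced (⟶-refl t∈))

      iterate-settled : ∀ xs → length (grow U (iterate xs)) ≤ length (iterate xs) → Closed (iterate xs)
      iterate-settled xs le r∈ s = subst (_ ∈_) stable (grow-intro r∈ s)
        where
        stable : grow U (iterate xs) ≡ iterate xs
        stable = trans (filterᵇ-⊆-stable U (iterate-grows xs)
          (≤-trans le (≤-reflexive (cong length (iterate-filter xs))))) (sym (iterate-filter xs))

      -- As long as the set is not closed, each round adds an element.
      iterate-progress : ∀ xs → Closed (iterate xs) ⊎ length xs ≤ length (iterate xs)
      iterate-progress []       = inj₂ z≤n
      iterate-progress (x ∷ xs) with length (grow U (iterate xs)) ≤? length (iterate xs) | iterate-progress xs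
      ... | no  h  | inj₂ le = inj₂ (≤-trans (s≤s le) (≰⇒> h))
      ... | no  h  | inj₁ cl = ⊥-elim (h (≤-trans
        (filterᵇ-⊆-length U λ t∈ g → let r , r∈ , i = any-elim {xs = iterate xs} g in
          proj₂ (filterᵇ-elim {xs = U} (subst (_ ∈_) (iterate-filter xs)
            (cl r∈ (step (⟶*-edge e∈U (iterate-sound xs r∈)) t∈ i)))))
        (≤-reflexive (cong length (sym (iterate-filter xs))))))
      ... | yes le | _ = inj₁ (λ r∈ s → grow-intro (iterate-settled xs le (back r∈) (⟶-refl (_⟶_.source s))) s)
        where
        back : ∀ {r} → r ∈ iterate (x ∷ xs) → r ∈ iterate xs
        back r∈ = let r∈U , g = filterᵇ-elim {p = λ t → any (λ r → Γ r t) (iterate xs)} {xs = U} r∈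
                      q , q∈ , i = any-elim {xs = iterate xs} g
                  in  iterate-settled xs le q∈ (step (⟶*-edge e∈U (iterate-sound xs q∈)) r∈U i)

    class-sound : ∀ {t} → t ∈ class U e → e ⟶* t
    class-sound = iterate-sound U

    class-self : e ∈ class U e
    class-self = iterate-self U

    class-closed : Closed (class U e)
    class-closed with iterate-progress U
    ... | inj₁ cl = cl
    -- The set now has at least as many elements as `U`, and a further round, being a selection from
    -- `U`, cannot be longer.
    ... | inj₂ le = iterate-settled U (≤-trans (length-filter _ U) le)

  oriented-intro : ∀ {O e} → e ∈ O → e ∈ U → T (oriented O e)
  oriented-intro e∈O e∈U = any-intro e∈O (_⟶_.forced (⟶-refl e∈U))

  oriented-elim : ∀ {O e} → (∀ {f} → f ∈ O → f ∈ U) → Closed O → e ∈ U → T (oriented O e) → e ∈ O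
  oriented-elim {O} sub cl e∈U h = let r , r∈ , g = any-elim {xs = O} h in cl r∈ (step (sub r∈) e∈U g)

  -- The edge that has caused e to be oriented as it is: no vertex of the
  -- class of e has been processed before its first vertex u.
  record Root (e : A × A) : Set where
    field
      {later earlier} : List A
      {u w}           : A
      position        : W ≡ later ++ u ∷ earlier
      path            : (u , w) ⟶* e
      minimal         : ∀ {p q} → p ∈ earlier → ¬ (e ⟶* (p , q)) × ¬ (e ⟶* (q , p))

  record Invariant (O : List (A × A)) : Set where
    field
      sub    : ∀ {e} → e ∈ O → e ∈ U
      closed : Closed O
      asym   : ∀ {e} → e ∈ O → swap e ∉ O
      root   : ∀ {e} → e ∈ O → Root e

  Decided : List (A × A) → A × A → Set
  Decided O e = e ∈ O ⊎ swap e ∈ O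

  -- Necessary for a transitive orientation, because a class is always oriented as a whole; the
  -- construction below shows that it is also sufficient.
  module _ (irreversible : ∀ {x y} → (x , y) ∈ U → ¬ ((x , y) ⟶* (y , x))) where

    module _ {later earlier x y} (pos : W ≡ later ++ x ∷ earlier) (e∈U : (x , y) ∈ U)
      {O} (inv : Invariant O) (done : ∀ {p q} → p ∈ earlier → (p , q) ∈ U → Decided O (p , q)) where

      open Invariant inv

      private
        e : A × A
        e = x , y

      -- `O` is a union of classes, so the class of `e` meets neither `O` nor its reverse. Every
      -- edge with an end in `earlier` is decided; hence the class of `e` has no vertex there, and
      -- `x` is its first vertex.
      extend-new : e ∉ O → swap e ∉ O → Invariant (class U e ++ O)
      extend-new e∉ e′∉ = record { sub = sub′ ; closed = closed′ ; asym = asym′ ; root = root′ }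
        where
        split : ∀ {f} → f ∈ class U e ++ O → e ⟶* f ⊎ f ∈ O
        split f∈ with ∈-++⁻ (class U e) f∈
        ... | inj₁ f∈ᶜ = inj₁ (class-sound e∈U f∈ᶜ)
        ... | inj₂ f∈ᴼ = inj₂ f∈ᴼ

        sub′ : ∀ {f} → f ∈ class U e ++ O → f ∈ U
        sub′ f∈ with split f∈
        ... | inj₁ p   = ⟶*-edge e∈U p
        ... | inj₂ f∈ᴼ = sub f∈ᴼ

        closed′ : Closed (class U e ++ O)
        closed′ f∈ s with ∈-++⁻ (class U e) f∈
        ... | inj₁ f∈ᶜ = ∈-++⁺ˡ (class-closed e∈U f∈ᶜ s)
        ... | inj₂ f∈ᴼ = ∈-++⁺ʳ (class U e) (closed f∈ᴼ s)

        asym′ : ∀ {f} → f ∈ class U e ++ O → swap f ∉ class U e ++ O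
        asym′ f∈ f′∈ with split f∈ | split f′∈
        ... | inj₁ p   | inj₁ p′   = irreversible e∈U (p ◅◅ ⟶*-sym (⟶*-swap p′))
        ... | inj₁ p   | inj₂ f′∈ᴼ = e′∉ (Closed* closed f′∈ᴼ (⟶*-sym (⟶*-swap p)))
        ... | inj₂ f∈ᴼ | inj₁ p′   = e′∉ (Closed* closed f∈ᴼ (⟶*-sym (⟶*-swap p′)))
        ... | inj₂ f∈ᴼ | inj₂ f′∈ᴼ = asym f∈ᴼ f′∈ᴼ

        avoided : ∀ {g} → Decided O g → ¬ (e ⟶* g)
        avoided (inj₁ g∈)  p = e∉ (Closed* closed g∈ (⟶*-sym p))
        avoided (inj₂ g′∈) p = e′∉ (Closed* closed g′∈ (⟶*-sym (⟶*-swap p)))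

        root′ : ∀ {f} → f ∈ class U e ++ O → Root f
        root′ f∈ with split f∈
        ... | inj₂ f∈ᴼ = root f∈ᴼ
        ... | inj₁ p   = record
          { position = pos
          ; path     = p
          ; minimal  = λ p∈ →
              (λ r → avoided (done p∈ (⟶*-edge e∈U (p ◅◅ r))) (p ◅◅ r)) ,
              (λ r → avoided ([ inj₂ , inj₁ ]′ (done p∈ (edge-swap (⟶*-edge e∈U (p ◅◅ r))))) (p ◅◅ r))
          }

      extend-step : let O′ = extend U e O in Invariant O′ × (∀ {f} → f ∈ O → f ∈ O′) × Decided O′ e
      extend-step = by-cases (oriented O e ∨ oriented O (swap e))
        (λ h → [ inj₁ ∘ oriented-elim sub closed e∈U , inj₂ ∘ oriented-elim sub closed (edge-swap e∈U) ]′
                 (Equivalence.to T-∨ h))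
        (λ ¬h → (λ e∈ → ¬h (Equivalence.from T-∨ (inj₁ (oriented-intro e∈ e∈U)))) ,
                (λ e∈ → ¬h (Equivalence.from (T-∨ {x = oriented O e}) (inj₂ (oriented-intro e∈ (edge-swap e∈U))))))
        where
        by-cases : ∀ b → (T b → Decided O e) → (¬ T b → e ∉ O × swap e ∉ O) →
                   let O′ = if b then O else class U e ++ O in
                   Invariant O′ × (∀ {f} → f ∈ O → f ∈ O′) × Decided O′ e
        by-cases true  old _   = inv , id , old _
        by-cases false _   new = let e∉ , e′∉ = new id in
          extend-new e∉ e′∉ , ∈-++⁺ʳ (class U e) , inj₁ (∈-++⁺ˡ (class-self e∈U))

    extend-all : ∀ {later earlier x} → W ≡ later ++ x ∷ earlier → ∀ {O} → Invariant O →
      (∀ {p q} → p ∈ earlier → (p , q) ∈ U → Decided O (p , q)) →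
      ∀ es → (∀ {e} → e ∈ es → e ∈ U × proj₁ e ≡ x) →
      let O′ = foldr (extend U) O es in
      Invariant O′ × (∀ {f} → f ∈ O → f ∈ O′) × (∀ {e} → e ∈ es → Decided O′ e)
    extend-all pos inv done []             es⊆ = inv , id , λ ()
    extend-all pos {O} inv done ((x , y) ∷ es) es⊆
      with refl ← proj₂ (es⊆ (here refl))
      with inv₁ , mono₁ , decided₁ ← extend-all pos {O} inv done es (es⊆ ∘ there)
      with inv₂ , mono₂ , decided₂ ← extend-step pos (proj₁ (es⊆ (here refl))) inv₁
             (λ p∈ e∈ → [ inj₁ ∘ mono₁ , inj₂ ∘ mono₁ ]′ (done p∈ e∈))
      = inv₂ , mono₂ ∘ mono₁ , λ
      { (here refl) → decided₂
      ; (there e∈)  → [ inj₁ ∘ mono₂ , inj₂ ∘ mono₂ ]′ (decided₁ e∈)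
      }

    edgesFrom : A → List (A × A)
    edgesFrom x = concatMap (λ y → if conf x y then [] else [ x , y ]) W

    ∈-edgesFrom : ∀ {p q} → (p , q) ∈ U → (p , q) ∈ edgesFrom p
    ∈-edgesFrom {p} {q} e∈ with concatMap-elim W e∈
    ... | x′ , x′∈ , e∈′ with concatMap-elim W e∈′
    ...   | y′ , y′∈ , e∈″ with conf x′ y′ in eq
    ...     | false with here refl ← e∈″ = e∈′

    edgesFrom-elim : ∀ {x e} → x ∈ W → e ∈ edgesFrom x → e ∈ U × proj₁ e ≡ x
    edgesFrom-elim {x} x∈ e∈ with concatMap-elim W e∈
    ... | y′ , y′∈ , e∈″ with conf x y′ in eq
    ...   | false with here refl ← e∈″ = concatMap-intro x∈ e∈ , refl

    -- `foldr` works from the end of the list, so the vertices already processed form a suffix of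
    -- `W`.
    process : ∀ later earlier → W ≡ later ++ earlier →
              let O = foldr (extend U) [] (concatMap edgesFrom earlier) in
              Invariant O × (∀ {p q} → p ∈ earlier → (p , q) ∈ U → Decided O (p , q))
    process later []            pos = record { sub = λ () ; closed = λ () ; asym = λ () ; root = λ () } , λ ()
    process later (x ∷ earlier) pos
      with inv , done ← process (later ++ [ x ]) earlier (trans pos (sym (++-assoc later [ x ] earlier)))
      rewrite foldr-++ (extend U) [] (edgesFrom x) (concatMap edgesFrom earlier)
      with inv′ , mono , decided ← extend-all pos inv done (edgesFrom x)
             (edgesFrom-elim (subst (x ∈_) (sym pos) (∈-++⁺ʳ later (here refl))))
      = inv′ , λ
      { (here refl) e∈ → decided (∈-edgesFrom e∈)
      ; (there p∈)  e∈ → [ inj₁ ∘ mono , inj₂ ∘ mono ]′ (done p∈ e∈)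
      }

    O : List (A × A)
    O = orient U

    invariant : Invariant O
    invariant = proj₁ (process [] W refl)

    open Invariant invariant

    total : ∀ {e} → e ∈ U → Decided O e
    total e∈ = proj₂ (process [] W refl) (proj₁ (edge-elim e∈)) e∈

    -- Golumbic's triangle lemma
    triangle : ∀ {a b c b′ c′} → (a , b) ∈ O → (c , a) ∈ O → (b , c) ∈ O → (b , c) ⟶* (b′ , c′) →
               (a , b′) ∈ O × (a , b) ⟶* (a , b′) × (c′ , a) ∈ O
    triangle ab ca bc ε = ab , ε , ca
    triangle {a} {b} {c} ab ca bc (_◅_ {j = b₁ , c₁} s ss) with forced-elim (_⟶_.forced s)
    ... | inj₁ (refl , c~c₁) =
      let bc₁ = closed bc s
          c₁∈ = proj₁ (proj₂ (edge-elim (sub bc₁)))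
          -- If `c₁` and `a` were in conflict, `(a , b)` would force `(c₁ , b)`, the reverse of
          -- `(b , c₁)`.
          c₁a∈U = edge-intro c₁∈ (proj₁ (edge-elim (sub ab))) λ c₁~a →
            asym bc₁ (closed ab (step (sub ab) (edge-swap (sub bc₁)) (forced-left (conf-sym c₁~a))))
      in  triangle ab (closed ca (step (sub ca) c₁a∈U (forced-left c~c₁))) bc₁ ss
    ... | inj₂ (refl , b~b₁) =
      let b₁c = closed bc s
          b₁∈ = proj₁ (edge-elim (sub b₁c))
          -- If `a` and `b₁` were in conflict, `(c , a)` would force `(c , b₁)`, the reverse of
          -- `(b₁ , c)`.
          ab₁∈U = edge-intro (proj₁ (edge-elim (sub ab))) b₁∈ λ a~b₁ →
            asym b₁c (closed ca (step (sub ca) (edge-swap (sub b₁c)) (forced-right a~b₁)))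
          ab⟶ab₁ = step (sub ab) ab₁∈U (forced-right b~b₁)
          ab′ , p , c′a = triangle (closed ab ab⟶ab₁) ca b₁c ss
      in  ab′ , ab⟶ab₁ ◅ p , c′a

    rootLength : ∀ {e} → Root e → ℕ
    rootLength r = length (Root.earlier r)

    -- The triangle lemma moves `(b , c)` to its root `(u , v)` while `a` stays, and puts `(a , u)`
    -- into the class of `(a , b)`. So `u` cannot come before the first vertex of that class. If it
    -- is this vertex, the class contains both `(a , u)` and an edge leaving `u`; the triangle lemma
    -- for the cycle of `v`, `a` and `u` then yields `(v , u)`, against `(u , v)`.
    no-cycle-via : ∀ {a b c} (ab : (a , b) ∈ O) (bc : (b , c) ∈ O) → (c , a) ∈ O →
                   ¬ (rootLength (root bc) ≤ rootLength (root ab))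
    no-cycle-via {a} {b} {c} ab bc ca le =
      [ (λ u≡u′ → let path = subst (λ z → (z , Root.w S) ⟶* (a , b)) (sym u≡u′) (Root.path S) in
          asym uv (proj₁ (triangle va uv au (⟶*-sym (path ◅◅ ab⟶*au)))))
      , (λ u∈ → proj₂ (Root.minimal S u∈) ab⟶*au)
      ]′ (shorter-suffix (Root.later R) (Root.later S) (trans (sym (Root.position R)) (Root.position S)) le)
      where
      R : Root (b , c)
      R = root bc

      S : Root (a , b)
      S = root ab

      u v : A
      u = Root.u R
      v = Root.w R

      uv : (u , v) ∈ O
      uv = Closed* closed bc (⟶*-sym (Root.path R))

      around : (a , u) ∈ O × (a , b) ⟶* (a , u) × (v , a) ∈ O
      around = triangle ab ca bc (⟶*-sym (Root.path R))

      au : (a , u) ∈ O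
      au = proj₁ around

      ab⟶*au : (a , b) ⟶* (a , u)
      ab⟶*au = proj₁ (proj₂ around)

      va : (v , a) ∈ O
      va = proj₂ (proj₂ around)

    -- The positions of the three roots cannot increase strictly at every step around the cycle, so
    -- some consecutive pair satisfies what `no-cycle-via` excludes.
    no-cycle : ∀ {a b c} → (a , b) ∈ O → (b , c) ∈ O → ¬ ((c , a) ∈ O)
    no-cycle ab bc ca with rootLength (root bc) ≤? rootLength (root ab) | rootLength (root ca) ≤? rootLength (root bc)
    ... | yes le | _      = no-cycle-via ab bc ca le
    ... | no _   | yes le = no-cycle-via bc ca ab le
    ... | no ≰₁  | no ≰₂  = no-cycle-via ca ab bc (≤-trans (<⇒≤ (≰⇒> ≰₁)) (<⇒≤ (≰⇒> ≰₂)))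

    O-trans : ∀ {a b c} → (a , b) ∈ O → (b , c) ∈ O → (a , c) ∈ O
    O-trans {a} {b} {c} ab bc =
      [ id , (λ ca → ⊥-elim (no-cycle ab bc ca)) ]′
      -- If `a` and `c` were in conflict, `(a , b)` would force `(c , b)`, the reverse of `(b , c)`.
      (total (edge-intro (proj₁ (edge-elim (sub ab))) (proj₁ (proj₂ (edge-elim (sub bc)))) λ a~c →
        asym bc (closed ab (step (sub ab) (edge-swap (sub bc)) (forced-left a~c)))))

    Apart : A → A → Set
    Apart x y = ¬ T (conf x y)

    Above : A → A → Set
    Above x y = (y , x) ∈ O

    -- By transitivity, layer `j` consists of the tops of the chains with `j + 1` elements.
    layer : ℕ → List A
    layer zero    = W
    layer (suc j) = next W O (layer j)

    next-intro : ∀ {L x y} → x ∈ L → (x , y) ∈ O → y ∈ next W O L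
    next-intro {L} {x} {y} x∈ xy = let _ , y∈ , ¬c = edge-elim (sub xy) in
      filterᵇ-intro y∈ (any-intro {p = λ x → not (conf x y) ∧ oriented O (x , y)} x∈
        (Equivalence.from T-∧ (T-not-intro ¬c , oriented-intro xy (sub xy))))

    next-elim : ∀ {L y} → (∀ {x} → x ∈ L → x ∈ W) → y ∈ next W O L → ∃[ x ] (x ∈ L × (x , y) ∈ O)
    next-elim {L} {y} L⊆ y∈ =
      let y∈W , h   = filterᵇ-elim {p = λ y → any (λ x → not (conf x y) ∧ oriented O (x , y)) L} {xs = W} y∈
          x , x∈ , g = any-elim {xs = L} h
          ¬c , o     = Equivalence.to T-∧ g
      in  x , x∈ , oriented-elim sub closed (edge-intro (L⊆ x∈) y∈W (T-not-elim ¬c)) o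

    layer⊆W : ∀ j {x} → x ∈ layer j → x ∈ W
    layer⊆W zero    x∈ = x∈
    layer⊆W (suc j) x∈ = proj₁ (filterᵇ-elim {xs = W} x∈)

    chain : ∀ j {x} → x ∈ layer j → ∃[ xs ] (length xs ≡ j × All (_∈ W) (x ∷ xs) × AllPairs Above (x ∷ xs))
    chain zero    x∈ = [] , refl , (x∈ ∷ []) , ([] ∷ [])
    chain (suc j) x∈ with next-elim (layer⊆W j) x∈
    ... | y , y∈ , yx with chain j y∈
    ...   | xs , len , in-W , (above ∷ pairs) =
      y ∷ xs , cong suc len , layer⊆W (suc j) x∈ ∷ in-W ,
      (yx ∷ All.map (λ zy → O-trans zy yx) above) ∷ above ∷ pairs

    -- The predicate `P` is there for the recursion: it carries along that everything inserted into
    -- the tail, `x` included, stays below the head.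
    insert : ∀ {P : A → Set} x xs → P x → All P xs → AllPairs Above xs →
             (∀ {y} → y ∈ xs → Decided O (x , y)) →
             ∃[ ys ] (length ys ≡ suc (length xs) × All P ys × AllPairs Above ys)
    insert x []       px []         []              cmp = [ x ] , refl , px ∷ [] , [] ∷ []
    insert {P} x (y ∷ xs) px (py ∷ pxs) (above ∷ pairs) cmp with cmp (here refl)
    ... | inj₂ yx = x ∷ y ∷ xs , refl , px ∷ py ∷ pxs , (yx ∷ All.map (λ zy → O-trans zy yx) above) ∷ above ∷ pairs
    ... | inj₁ xy with insert {λ z → P z × Above y z} x xs (px , xy) (All.zip (pxs , above)) pairs (cmp ∘ there)
    ...   | ys , len , all , pairs′ = y ∷ ys , cong suc len , py ∷ All.map proj₁ all , All.map proj₂ all ∷ pairs′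

    sort : ∀ xs → All (_∈ W) xs → AllPairs Apart xs → ∃[ ys ] (length ys ≡ length xs × All (_∈ xs) ys × AllPairs Above ys)
    sort []       []           []              = [] , refl , [] , []
    sort (x ∷ xs) (x∈ ∷ in-W) (apart ∷ pairs) with sort xs in-W pairs
    ... | ys , len , ys⊆ , pairs′
      with insert x ys (here refl) (All.map there ys⊆) pairs′
             (λ y∈ → let y∈xs = All.lookup ys⊆ y∈ in
               total (edge-intro x∈ (All.lookup in-W y∈xs) (All.lookup apart y∈xs)))
    ...   | zs , len′ , zs⊆ , pairs″ = zs , trans len′ (cong suc len) , zs⊆ , pairs″

    chain⇒layer : ∀ {x} xs → x ∈ W → AllPairs Above (x ∷ xs) → x ∈ layer (length xs)
    chain⇒layer []       x∈ _                            = x∈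
    chain⇒layer (y ∷ xs) x∈ ((yx ∷ _) ∷ (above ∷ pairs)) =
      next-intro (chain⇒layer xs (proj₁ (edge-elim (sub yx))) (above ∷ pairs)) yx

    below : ℕ → List (List A)
    below zero    = [] ∷ []
    below (suc j) = layer j ∷ below j

    length-below : ∀ j → length (below j) ≡ suc j
    length-below zero    = refl
    length-below (suc j) = cong suc (length-below j)

    record Reached (r j : ℕ) (s : List (List A)) : Set where
      field
        isStack  : s ≡ layer j ∷ below j
        nonempty : ∀ {i} → suc i ≤ j → ∃[ x ] x ∈ layer i
        maximal  : j ≡ r ⊎ layer j ≡ []

    push-cases : ∀ L s → (L ≡ [] × push W O (L ∷ s) ≡ L ∷ s)
                       ⊎ ((∃[ x ] x ∈ L) × push W O (L ∷ s) ≡ next W O L ∷ L ∷ s)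
    push-cases []      s = inj₁ (refl , refl)
    push-cases (x ∷ L) s = inj₂ ((x , here refl) , refl)

    layers-reached : ∀ {B : Set} (rounds : List B) → ∃[ j ] Reached (length rounds) j (layers rounds W)
    layers-reached []           = 0 , record { isStack = refl ; nonempty = λ () ; maximal = inj₁ refl }
    layers-reached (_ ∷ rounds) with layers-reached rounds
    ... | j , record { isStack = eq ; nonempty = ne ; maximal = max } with push-cases (layer j) (below j)
    ...   | inj₁ (empty , p) = j , record
      { isStack = trans (cong (push W O) eq) p ; nonempty = ne ; maximal = inj₂ empty }
    ...   | inj₂ ((x , x∈) , p) = suc j , record
      { isStack  = trans (cong (push W O) eq) p
      ; nonempty = λ { {i} i<1+j → [ (λ i<j → ne i<j) , (λ { refl → x , x∈ }) ]′ (m≤n⇒m<n∨m≡n (s≤s⁻¹ i<1+j)) }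
      -- Had the climb stopped earlier, the top layer would be empty, but it contains `x`.
      ; maximal  = inj₁ (cong suc ([ id , (λ empty → ⊥-elim (no-member (subst (x ∈_) empty x∈))) ]′ max))
      }
      where
      no-member : x ∉ []
      no-member ()

    -- The element that `suc (length xs)` counts in addition is the member at which the circle is
    -- cut.
    layers-sound : ∀ {B : Set} (rounds : List B) {k} → suc k ≤ length (layers rounds W) →
      ∃[ xs ] (k ≤ suc (length xs) × All (_∈ W) xs × AllPairs Apart xs)
    layers-sound rounds {k} k< with layers-reached rounds
    ... | j , record { isStack = isStack ; nonempty = nonempty } = from-length j nonempty
      (≤-trans (s≤s⁻¹ (≤-trans k< (≤-reflexive (cong length isStack)))) (≤-reflexive (length-below j)))
      where
      from-length : ∀ j → (∀ {i} → suc i ≤ j → ∃[ x ] x ∈ layer i) → k ≤ suc j →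
                    ∃[ xs ] (k ≤ suc (length xs) × All (_∈ W) xs × AllPairs Apart xs)
      from-length zero    _  k≤ = [] , k≤ , [] , []
      from-length (suc j) ne k≤ =
        let x , x∈                   = ne ≤-refl
            xs , len , in-W , above = chain j x∈
        in  x ∷ xs , subst (λ l → k ≤ suc (suc l)) (sym len) k≤ , in-W ,
            AllPairs.map (λ yx c → proj₂ (proj₂ (edge-elim (sub yx))) (conf-sym c)) above

    -- If `xs` has more than `j` elements, it can be sorted into a chain, whose last `j + 1`
    -- elements have their top in layer `j`. So the climb did not end at an empty layer; it used all
    -- rounds, of which there are enough.
    layers-complete : ∀ {B : Set} (rounds : List B) xs → All (_∈ W) xs → AllPairs Apart xs →
      length xs ≤ length rounds → suc (suc (length xs)) ≤ length (layers rounds W)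
    layers-complete rounds xs in-W apart len≤ with layers-reached rounds
    ... | j , reached = ≤-trans (s≤s (s≤s bound))
      (≤-reflexive (sym (trans (cong length (Reached.isStack reached)) (cong suc (length-below j)))))
      where
      member : ∀ ys → suc j ≤ length ys → All (_∈ W) ys → AllPairs Above ys → ∃[ y ] y ∈ layer j
      member (y ∷ ys) j< (y∈ ∷ ys∈) above with m≤n⇒m<n∨m≡n j<
      ... | inj₂ refl = y , chain⇒layer ys y∈ above
      ... | inj₁ j<′  = member ys (s≤s⁻¹ j<′) ys∈ (AllPairs.tail above)

      no-member : ∀ {x : A} → x ∉ []
      no-member ()

      bound : length xs ≤ j
      bound with length xs ≤? j | Reached.maximal reached
      ... | yes le | _          = le
      ... | no _   | inj₁ refl  = len≤
      ... | no ≰   | inj₂ empty =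
        let ys , len , ys⊆ , above = sort xs in-W apart
            y , y∈ = member ys (≤-trans (≰⇒> ≰) (≤-reflexive (sym len))) (All.map (All.lookup in-W) ys⊆) above
        in  ⊥-elim (no-member (subst (y ∈_) empty y∈))

-- The order of real numbers and of points

open ℝ using (Lower; Upper)

cut-< : ∀ x {q r} → Lower x q → Upper x r → q ℚ.< r
cut-< x {q} {r} l u with ℚ.<-cmp q r
... | tri< q<r _ _    = q<r
... | tri≈ _ refl _   = ⊥-elim (ℝ.disjoint x q (l , u))
... | tri> _ _ r<q    = ⊥-elim (ℝ.disjoint x r (ℝ.lower-closed x r<q l , u))

<ᴿ-irrefl : ∀ {x} → ¬ (x <ᴿ x)
<ᴿ-irrefl {x} (q , u , l) = ℝ.disjoint x q (l , u)

<ᴿ-trans : ∀ {x y z} → x <ᴿ y → y <ᴿ z → x <ᴿ z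
<ᴿ-trans {y = y} {z} (q , xu , yl) (r , yu , zl) = q , xu , ℝ.lower-closed z (cut-< y yl yu) zl

-- `y ≤ᴿ z` is a negation and supplies no rational number; openness of the cut `y` leaves room for
-- locatedness of `z` to find one.
<-≤ᴿ-trans : ∀ {x y z} → x <ᴿ y → y ≤ᴿ z → x <ᴿ z
<-≤ᴿ-trans {y = y} {z} (q , xu , yl) y≤z with ℝ.lower-open y yl
... | r , q<r , yr with ℝ.located z q<r
...   | inj₁ zl = q , xu , zl
...   | inj₂ zu = ⊥-elim (y≤z (r , zu , yr))

≤-<ᴿ-trans : ∀ {x y z} → x ≤ᴿ y → y <ᴿ z → x <ᴿ z
≤-<ᴿ-trans {x} {y} x≤y (q , yu , zl) with ℝ.upper-open y yu
... | r , r<q , yr with ℝ.located x r<q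
...   | inj₁ xl = ⊥-elim (x≤y (r , yr , xl))
...   | inj₂ xu = q , xu , zl

≈-refl : ∀ {p : Point} → p ≈ p
≈-refl {p} = <ᴿ-irrefl {position p} , <ᴿ-irrefl {position p}

≈-sym : ∀ {p q : Point} → p ≈ q → q ≈ p
≈-sym = swap

<-irrefl : ∀ {p : Point} → ¬ (p < p)
<-irrefl {p} = <ᴿ-irrefl {position p}

<-trans : ∀ {p q r : Point} → p < q → q < r → p < r
<-trans {p} {q} {r} = <ᴿ-trans {position p} {position q} {position r}

<-asym : ∀ {p q : Point} → p < q → ¬ (q < p)
<-asym {p} {q} p<q q<p = <-irrefl {p} (<-trans {p} {q} {p} p<q q<p)

<-respʳ : ∀ {p q r : Point} → q ≈ r → p < q → p < r
<-respʳ {p} {q} {r} q≈r p<q = <-≤ᴿ-trans {position p} {position q} {position r} p<q (proj₁ q≈r)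

<-respˡ : ∀ {p q r : Point} → p ≈ q → p < r → q < r
<-respˡ {p} {q} {r} p≈q p<r = ≤-<ᴿ-trans {position q} {position p} {position r} (proj₂ p≈q) p<r

≈-trans : ∀ {p q r : Point} → p ≈ q → q ≈ r → p ≈ r
≈-trans {p} {q} {r} p≈q q≈r =
  (λ r<p → proj₁ q≈r (<-respʳ {r} {p} {q} p≈q r<p)) , (λ p<r → proj₂ q≈r (<-respˡ {p} {q} {r} p≈q p<r))

<⇒≼ : ∀ {p q : Point} → p < q → p ≼ q
<⇒≼ {p} {q} = <-asym {p} {q}

-- Trichotomy holds only classically, which is enough for negative goals.
compare : ∀ (p q : Point) → (p < q → ⊥) → (p ≈ q → ⊥) → (q < p → ⊥) → ⊥
compare p q lt eq gt = eq (gt , lt)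

-- The cyclic order of the points of the circle

Cyclic : Point → Point → Point → Set
Cyclic p q r = (p < q × q < r) ⊎ (q < r × r < p) ⊎ (r < p × p < q)

rotate : ∀ {p q r} → Cyclic p q r → Cyclic q r p
rotate (inj₁ (p<q , q<r))        = inj₂ (inj₂ (p<q , q<r))
rotate (inj₂ (inj₁ (q<r , r<p))) = inj₁ (q<r , r<p)
rotate (inj₂ (inj₂ (r<p , p<q))) = inj₂ (inj₁ (r<p , p<q))

Cyclic-respˡ : ∀ {p p′ q r} → p ≈ p′ → Cyclic p q r → Cyclic p′ q r
Cyclic-respˡ {p} {p′} {q} {r} p≈ (inj₁ (p<q , q<r))        = inj₁ (<-respˡ {p} {p′} {q} p≈ p<q , q<r)
Cyclic-respˡ {p} {p′} {q} {r} p≈ (inj₂ (inj₁ (q<r , r<p))) = inj₂ (inj₁ (q<r , <-respʳ {r} {p} {p′} p≈ r<p))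
Cyclic-respˡ {p} {p′} {q} {r} p≈ (inj₂ (inj₂ (r<p , p<q))) =
  inj₂ (inj₂ (<-respʳ {r} {p} {p′} p≈ r<p , <-respˡ {p} {p′} {q} p≈ p<q))

Cyclic-respᵐ : ∀ {p q q′ r} → q ≈ q′ → Cyclic p q r → Cyclic p q′ r
Cyclic-respᵐ {p} {q} {q′} {r} q≈ c = rotate {r} {p} {q′} (rotate {q′} {r} {p} (Cyclic-respˡ {q} {q′} {r} {p} q≈ (rotate {p} {q} {r} c)))

Cyclic-respʳ : ∀ {p q r r′} → r ≈ r′ → Cyclic p q r → Cyclic p q r′
Cyclic-respʳ {p} {q} {r} {r′} r≈ c = rotate {r′} {p} {q} (Cyclic-respˡ {r} {r′} {p} {q} r≈ (rotate {q} {r} {p} (rotate {p} {q} {r} c)))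

Cyclic-asym : ∀ {p q r} → Cyclic p q r → ¬ Cyclic p r q
Cyclic-asym {p} {q} {r} (inj₁ (p<q , q<r))        (inj₁ (p<r , r<q))        = <-asym {q} {r} q<r r<q
Cyclic-asym {p} {q} {r} (inj₁ (p<q , q<r))        (inj₂ (inj₁ (r<q , q<p))) = <-asym {q} {r} q<r r<q
Cyclic-asym {p} {q} {r} (inj₁ (p<q , q<r))        (inj₂ (inj₂ (q<p , p<r))) = <-asym {p} {q} p<q q<p
Cyclic-asym {p} {q} {r} (inj₂ (inj₁ (q<r , r<p))) (inj₁ (p<r , r<q))        = <-asym {q} {r} q<r r<q
Cyclic-asym {p} {q} {r} (inj₂ (inj₁ (q<r , r<p))) (inj₂ (inj₁ (r<q , q<p))) = <-asym {q} {r} q<r r<q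
Cyclic-asym {p} {q} {r} (inj₂ (inj₁ (q<r , r<p))) (inj₂ (inj₂ (q<p , p<r))) = <-asym {r} {p} r<p p<r
Cyclic-asym {p} {q} {r} (inj₂ (inj₂ (r<p , p<q))) (inj₁ (p<r , r<q))        = <-asym {r} {p} r<p p<r
Cyclic-asym {p} {q} {r} (inj₂ (inj₂ (r<p , p<q))) (inj₂ (inj₁ (r<q , q<p))) = <-asym {p} {q} p<q q<p
Cyclic-asym {p} {q} {r} (inj₂ (inj₂ (r<p , p<q))) (inj₂ (inj₂ (q<p , p<r))) = <-asym {p} {q} p<q q<p

Cyclic-distinct : ∀ {p q r} → Cyclic p q r → ¬ (q ≈ r)
Cyclic-distinct {p} {q} {r} c q≈r =
  Cyclic-asym {p} {q} {r} c (Cyclic-respᵐ {p} {q} {r} {q} q≈r (Cyclic-respʳ {p} {q} {r} {q} (≈-sym {q} {r} q≈r) c))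

Cyclic-trans : ∀ {a b c d} → Cyclic a b c → Cyclic a c d → Cyclic a b d
Cyclic-trans {a} {b} {c} {d} (inj₁ (a<b , b<c)) (inj₁ (a<c , c<d)) = inj₁ (a<b , <-trans {b} {c} {d} b<c c<d)
Cyclic-trans {a} {b} {c} {d} (inj₁ (a<b , b<c)) (inj₂ (inj₁ (c<d , d<a))) =
  inj₁ (a<b , <-trans {b} {c} {d} b<c c<d)
Cyclic-trans {a} {b} {c} {d} (inj₁ (a<b , b<c)) (inj₂ (inj₂ (d<a , a<c))) = inj₂ (inj₂ (d<a , a<b))
Cyclic-trans {a} {b} {c} {d} (inj₂ (inj₁ (b<c , c<a))) (inj₁ (a<c , c<d)) = ⊥-elim (<-asym {a} {c} a<c c<a)
Cyclic-trans {a} {b} {c} {d} (inj₂ (inj₁ (b<c , c<a))) (inj₂ (inj₁ (c<d , d<a))) =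
  inj₂ (inj₁ (<-trans {b} {c} {d} b<c c<d , d<a))
Cyclic-trans {a} {b} {c} {d} (inj₂ (inj₁ (b<c , c<a))) (inj₂ (inj₂ (d<a , a<c))) = ⊥-elim (<-asym {a} {c} a<c c<a)
Cyclic-trans {a} {b} {c} {d} (inj₂ (inj₂ (c<a , a<b))) (inj₁ (a<c , c<d)) = ⊥-elim (<-asym {a} {c} a<c c<a)
Cyclic-trans {a} {b} {c} {d} (inj₂ (inj₂ (c<a , a<b))) (inj₂ (inj₁ (c<d , d<a))) = inj₂ (inj₂ (d<a , a<b))
Cyclic-trans {a} {b} {c} {d} (inj₂ (inj₂ (c<a , a<b))) (inj₂ (inj₂ (d<a , a<c))) = inj₂ (inj₂ (d<a , a<b))

Cyclic-total : ∀ {p q r} → ¬ (p ≈ q) → ¬ (q ≈ r) → ¬ (p ≈ r) → (Cyclic p q r → ⊥) → (Cyclic p r q → ⊥) → ⊥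
Cyclic-total {p} {q} {r} p≉q q≉r p≉r pqr prq =
  compare p q
    (λ p<q → compare q r (λ q<r → pqr (inj₁ (p<q , q<r))) q≉r
      (λ r<q → compare p r (λ p<r → prq (inj₁ (p<r , r<q))) p≉r (λ r<p → pqr (inj₂ (inj₂ (r<p , p<q))))))
    p≉q
    (λ q<p → compare q r
      (λ q<r → compare p r (λ p<r → prq (inj₂ (inj₂ (q<p , p<r)))) p≉r (λ r<p → pqr (inj₂ (inj₁ (q<r , r<p)))))
      q≉r
      (λ r<q → prq (inj₂ (inj₁ (r<q , q<p)))))

-- Arcs in terms of the cyclic order

-- Agrees with `_∈ᴬ_` up to double negation, but spares the distinction of whether the arc passes
-- through 0.
On : Point → Arc → Set
On p a = p ≈ start a ⊎ p ≈ end a ⊎ Cyclic (start a) p (end a)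

∈ᴬ⇒On : ∀ {p} a → p ∈ᴬ a → (On p a → ⊥) → ⊥
∈ᴬ⇒On {p} a (inj₁ (s<e , s≼p , p≼e)) k =
  compare p (start a) s≼p (λ eq → k (inj₁ eq)) λ s<p →
  compare p (end a) (λ p<e → k (inj₂ (inj₂ (inj₁ (s<p , p<e))))) (λ eq → k (inj₂ (inj₁ eq))) p≼e
∈ᴬ⇒On {p} a (inj₂ (e<s , inj₁ s≼p)) k =
  compare p (start a) s≼p (λ eq → k (inj₁ eq)) (λ s<p → k (inj₂ (inj₂ (inj₂ (inj₂ (e<s , s<p))))))
∈ᴬ⇒On {p} a (inj₂ (e<s , inj₂ p≼e)) k =
  compare p (end a) (λ p<e → k (inj₂ (inj₂ (inj₂ (inj₁ (p<e , e<s)))))) (λ eq → k (inj₂ (inj₁ eq))) p≼e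

On⇒∈ᴬ : ∀ {p} a → On p a → (p ∈ᴬ a → ⊥) → ⊥
On⇒∈ᴬ {p} a on k = compare (start a) (end a)
  (λ s<e → k (inj₁ (s<e , forward s<e on)))
  (distinct a)
  (λ e<s → k (inj₂ (e<s , backward e<s on)))
  where
  s e : Point
  s = start a
  e = end a
  forward : s < e → On p a → s ≼ p × p ≼ e
  forward s<e (inj₁ p≈s)        = proj₂ p≈s , <⇒≼ {p} {e} (<-respˡ {s} {p} {e} (≈-sym {p} {s} p≈s) s<e)
  forward s<e (inj₂ (inj₁ p≈e)) = <⇒≼ {s} {p} (<-respʳ {s} {e} {p} (≈-sym {p} {e} p≈e) s<e) , proj₁ p≈e
  forward s<e (inj₂ (inj₂ (inj₁ (s<p , p<e))))        = <⇒≼ {s} {p} s<p , <⇒≼ {p} {e} p<e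
  forward s<e (inj₂ (inj₂ (inj₂ (inj₁ (p<e , e<s))))) = ⊥-elim (<-asym {s} {e} s<e e<s)
  forward s<e (inj₂ (inj₂ (inj₂ (inj₂ (e<s , s<p))))) = ⊥-elim (<-asym {s} {e} s<e e<s)
  backward : e < s → On p a → s ≼ p ⊎ p ≼ e
  backward e<s (inj₁ p≈s)        = inj₁ (proj₂ p≈s)
  backward e<s (inj₂ (inj₁ p≈e)) = inj₂ (proj₁ p≈e)
  backward e<s (inj₂ (inj₂ (inj₁ (s<p , _))))        = inj₁ (<⇒≼ {s} {p} s<p)
  backward e<s (inj₂ (inj₂ (inj₂ (inj₁ (p<e , _))))) = inj₂ (<⇒≼ {p} {e} p<e)
  backward e<s (inj₂ (inj₂ (inj₂ (inj₂ (_ , s<p))))) = inj₁ (<⇒≼ {s} {p} s<p)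

Apartᴬ : Arc → Arc → Set₁
Apartᴬ a b = ¬ MeetInMoreThanOnePoint a b

share-one : ∀ {a b} → Apartᴬ a b → ∀ {p q} → On p a → On p b → On q a → On q b → ¬ ¬ (p ≈ q)
share-one {a} {b} ap {p} {q} pa pb qa qb p≉q =
  On⇒∈ᴬ {p} a pa λ pa → On⇒∈ᴬ {p} b pb λ pb → On⇒∈ᴬ {q} a qa λ qa → On⇒∈ᴬ {q} b qb λ qb →
  ap (p , q , p≉q , (pa , pb) , (qa , qb))

-- The arcs a and b share start b, and also end a or end b, whichever is
-- reached first from there.
start-on : ∀ {a b} → Apartᴬ a b → On (start b) a → ¬ ¬ (start b ≈ end a)
start-on {a} {b} ap on t≉e = compare e e′ (λ lt → apart (λ eq → proj₂ eq lt) on) same (λ gt → apart (λ eq → proj₁ eq gt) on)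
  where
  s e t e′ : Point
  s  = start a
  e  = end a
  t  = start b
  e′ = end b

  on-t : On t b
  on-t = inj₁ (≈-refl {t})

  same : ¬ (e ≈ e′)
  same e≈e′ = share-one {a} {b} ap {t} {e} on on-t (inj₂ (inj₁ (≈-refl {e}))) (inj₂ (inj₁ e≈e′)) t≉e

  end-a : Cyclic t e e′ → ⊥
  end-a c = share-one {a} {b} ap {t} {e} on on-t (inj₂ (inj₁ (≈-refl {e}))) (inj₂ (inj₂ c)) t≉e

  end-b : Cyclic s e′ e → ⊥
  end-b c = share-one {a} {b} ap {t} {e′} on on-t (inj₂ (inj₂ c)) (inj₂ (inj₁ (≈-refl {e′}))) (distinct b)

  apart : ¬ (e ≈ e′) → On t a → ⊥
  apart e≉e′ (inj₁ t≈s) = Cyclic-total {s} {e} {e′} (distinct a) e≉e′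
    (λ s≈e′ → distinct b (≈-trans {t} {s} {e′} t≈s s≈e′))
    (λ c → end-a (Cyclic-respˡ {s} {t} {e} {e′} (≈-sym {t} {s} t≈s) c)) end-b
  apart e≉e′ (inj₂ (inj₁ t≈e)) = t≉e t≈e
  apart e≉e′ (inj₂ (inj₂ ste)) = Cyclic-total {t} {e} {e′} t≉e e≉e′ (distinct b) end-a λ te′e →
    end-b (rotate {e} {s} {e′} (Cyclic-trans {e} {s} {t} {e′}
      (rotate {t} {e} {s} (rotate {s} {t} {e} ste)) (rotate {e′} {e} {t} (rotate {t} {e′} {e} te′e))))

starts-distinct : ∀ {a b} → Apartᴬ a b → ¬ (start a ≈ start b)
starts-distinct {a} {b} ap eq = start-on {a} {b} ap (inj₁ (≈-sym {start a} {start b} eq))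
  (λ eq′ → distinct a (≈-trans {start a} {start b} {end a} eq eq′))

-- Going back from the common point `p`, the start that is reached first lies on both arcs.
starts-meet : ∀ {a b p} → On p a → On p b → (On (start a) b → ⊥) → (On (start b) a → ⊥) → ⊥
starts-meet {a} {b} {p} pa pb ¬sb ¬ta = go pa pb
  where
  s e t f : Point
  s = start a
  e = end a
  t = start b
  f = end b

  go : On p a → On p b → ⊥
  go (inj₁ p≈s) pb = ¬sb (resp pb)
    where
    resp : On p b → On s b
    resp (inj₁ p≈t)        = inj₁ (≈-trans {s} {p} {t} (≈-sym {p} {s} p≈s) p≈t)
    resp (inj₂ (inj₁ p≈f)) = inj₂ (inj₁ (≈-trans {s} {p} {f} (≈-sym {p} {s} p≈s) p≈f))
    resp (inj₂ (inj₂ c))   = inj₂ (inj₂ (Cyclic-respᵐ {t} {p} {s} {f} p≈s c))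
  go pa (inj₁ p≈t) = ¬ta (resp pa)
    where
    resp : On p a → On t a
    resp (inj₁ p≈s)        = inj₁ (≈-trans {t} {p} {s} (≈-sym {p} {t} p≈t) p≈s)
    resp (inj₂ (inj₁ p≈e)) = inj₂ (inj₁ (≈-trans {t} {p} {e} (≈-sym {p} {t} p≈t) p≈e))
    resp (inj₂ (inj₂ c))   = inj₂ (inj₂ (Cyclic-respᵐ {s} {p} {t} {e} p≈t c))
  go (inj₂ pa) (inj₂ pb) = Cyclic-total {s} {t} {p} (λ s≈t → ¬sb (inj₁ s≈t))
    (λ t≈p → t-on-a t≈p pa) (λ s≈p → s-on-b s≈p pb)
    (λ c → ¬ta (inj₂ (reach c pa)))
    (λ c → ¬sb (inj₂ (reach′ (rotate {p} {t} {s} (rotate {s} {p} {t} c)) pb)))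
    where
    t-on-a : t ≈ p → (p ≈ e ⊎ Cyclic s p e) → ⊥
    t-on-a t≈p (inj₁ p≈e) = ¬ta (inj₂ (inj₁ (≈-trans {t} {p} {e} t≈p p≈e)))
    t-on-a t≈p (inj₂ c)   = ¬ta (inj₂ (inj₂ (Cyclic-respᵐ {s} {p} {t} {e} (≈-sym {t} {p} t≈p) c)))
    s-on-b : s ≈ p → (p ≈ f ⊎ Cyclic t p f) → ⊥
    s-on-b s≈p (inj₁ p≈f) = ¬sb (inj₂ (inj₁ (≈-trans {s} {p} {f} s≈p p≈f)))
    s-on-b s≈p (inj₂ c)   = ¬sb (inj₂ (inj₂ (Cyclic-respᵐ {t} {p} {s} {f} (≈-sym {s} {p} s≈p) c)))
    reach : Cyclic s t p → (p ≈ e ⊎ Cyclic s p e) → (t ≈ e ⊎ Cyclic s t e)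
    reach c (inj₁ p≈e) = inj₂ (Cyclic-respʳ {s} {t} {p} {e} p≈e c)
    reach c (inj₂ d)   = inj₂ (Cyclic-trans {s} {t} {p} {e} c d)
    reach′ : Cyclic t s p → (p ≈ f ⊎ Cyclic t p f) → (s ≈ f ⊎ Cyclic t s f)
    reach′ c (inj₁ p≈f) = inj₂ (Cyclic-respʳ {t} {s} {p} {f} p≈f c)
    reach′ c (inj₂ d)   = inj₂ (Cyclic-trans {t} {s} {p} {f} c d)

-- On its way to `p`, the arc `a` would pass `start b` strictly before its end, whereas `start-on`
-- leaves only `end a` as a place for it.
passes : ∀ {a b p} → Apartᴬ a b → On p a → Cyclic (start a) (start b) p → ⊥
passes {a} {b} {p} ap on c = start-on {a} {b} ap (inj₂ (inj₂ (reach on)))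
  (λ t≈e → Cyclic-distinct {s} {t} {e} (reach on) t≈e)
  where
  s e t : Point
  s = start a
  e = end a
  t = start b
  reach : On p a → Cyclic s t e
  reach (inj₁ p≈s)        = ⊥-elim (Cyclic-distinct {t} {p} {s} (rotate {s} {t} {p} c) p≈s)
  reach (inj₂ (inj₁ p≈e)) = Cyclic-respʳ {s} {t} {p} {e} p≈e c
  reach (inj₂ (inj₂ d))   = Cyclic-trans {s} {t} {p} {e} c d

CyclicArcs : Arc → Arc → Arc → Set
CyclicArcs a b c = Cyclic (start a) (start b) (start c)

CyclicArcs-total : ∀ {a b c} → Apartᴬ a b → Apartᴬ b c → Apartᴬ a c →
                   (CyclicArcs a b c → ⊥) → (CyclicArcs a c b → ⊥) → ⊥
CyclicArcs-total {a} {b} {c} ab bc ac = Cyclic-total {start a} {start b} {start c}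
  (starts-distinct {a} {b} ab) (starts-distinct {b} {c} bc) (starts-distinct {a} {c} ac)

-- If g lay between s and y but g′ between y and s, then the one of the arcs
-- g and g′ in which the other starts would contain y or s on the way.
CyclicArcs-move : ∀ {s g y g′} → Apartᴬ s y → Apartᴬ g y → Apartᴬ g′ s → Apartᴬ g′ y →
  ¬ Disjoint g g′ → CyclicArcs s g y → (CyclicArcs s g′ y → ⊥) → ⊥
CyclicArcs-move {s} {g} {y} {g′} sy gy g′s g′y meet sgy ¬sg′y =
  CyclicArcs-total {s} {g′} {y} (λ m → g′s (swap-meet m)) g′y sy ¬sg′y λ syg′ →
  meet λ p → λ { (pg , pg′) →
    ∈ᴬ⇒On {p} g pg λ pg → ∈ᴬ⇒On {p} g′ pg′ λ pg′ →
    starts-meet {g} {g′} {p} pg pg′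
      (λ G∈g′ → passes {g′} {s} {G} g′s G∈g′ (rotate {G} {G′} {S} (rotate {S} {G} {G′}
        (Cyclic-trans {S} {G} {Y} {G′} sgy syg′))))
      (λ G′∈g → passes {g} {y} {G′} gy G′∈g (rotate {G′} {G} {Y} (rotate {Y} {G′} {G}
        (Cyclic-trans {Y} {G′} {S} {G} (rotate {S} {Y} {G′} syg′) (rotate {G} {Y} {S} (rotate {S} {G} {Y} sgy)))))) }
  where
  S G Y G′ : Point
  S  = start s
  G  = start g
  Y  = start y
  G′ = start g′
  swap-meet : MeetInMoreThanOnePoint s g′ → MeetInMoreThanOnePoint g′ s
  swap-meet (p , q , p≉q , (ps , pg) , (qs , qg)) = p , q , p≉q , (pg , ps) , (qg , qs)

-- Induced matchings as independent sets of embeddings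

all-intro : ∀ {A : Set} {p : A → Bool} xs → (∀ x → T (p x)) → T (all p xs)
all-intro []       h = _
all-intro (x ∷ xs) h = Equivalence.from T-∧ (h x , all-intro xs h)

all-elim : ∀ {A : Set} {p : A → Bool} {x xs} → T (all p xs) → x ∈ xs → T (p x)
all-elim h (here refl) = proj₁ (Equivalence.to T-∧ h)
all-elim h (there x∈)  = all-elim (proj₂ (Equivalence.to T-∧ h)) x∈

sameVertex⇒≡ : ∀ {n} {a b : Fin n} → T (sameVertex a b) → a ≡ b
sameVertex⇒≡ {a = a} {b} h = toℕ-injective (≡ᵇ⇒≡ (toℕ a) (toℕ b) h)

sameVertex-refl : ∀ {n} (a : Fin n) → T (sameVertex a a)
sameVertex-refl a = ≡⇒≡ᵇ (toℕ a) (toℕ a) refl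

lookup-injective : ∀ {A : Set} {m} {x y : Vec A m} → (∀ i → lookup x i ≡ lookup y i) → x ≡ y
lookup-injective {x = x} {y} h = trans (sym (tabulate∘lookup x)) (trans (Vec-tabulate-cong h) (tabulate∘lookup y))

reflects : ∀ {P : Set} b → (T b → P) → (P → T b) → Reflects P b
reflects true  sound _        = ofʸ (sound _)
reflects false _     complete = ofⁿ complete

∈-tuples : ∀ {n m} (x : Vec (Fin n) m) → x ∈ tuples n m
∈-tuples []       = here refl
∈-tuples (a ∷ as) = concatMap-intro (∈-allFin a) (concatMap-intro (∈-tuples as) (here refl))

AllPairs-lookup : ∀ {A : Set} {R : A → A → Set} → (∀ {x y} → R x y → R y x) → ∀ {xs} → AllPairs R xs →
                  ∀ i j → i ≢ j → R (List.lookup xs i) (List.lookup xs j)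
AllPairs-lookup R-sym (px ∷ pxs) zero    zero    i≢j = ⊥-elim (i≢j refl)
AllPairs-lookup R-sym (px ∷ pxs) zero    (suc j) i≢j = All.lookup px (∈-lookup j)
AllPairs-lookup R-sym (px ∷ pxs) (suc i) zero    i≢j = R-sym (All.lookup px (∈-lookup i))
AllPairs-lookup R-sym (px ∷ pxs) (suc i) (suc j) i≢j = AllPairs-lookup R-sym pxs i j (i≢j ∘ cong suc)

module Matching {m n : ℕ} (H : Graph m) (G : Graph n) where
  open Decision H G
  open Tuples m

  Conflict : Vec (Fin n) m → Vec (Fin n) m → Set
  Conflict x y = T (conflict G x y)

  sameTuple⇒≡ : ∀ {x y : Vec (Fin n) m} → T (sameTuple x y) → x ≡ y
  sameTuple⇒≡ h = lookup-injective λ i → sameVertex⇒≡ (all-elim h (∈-allFin i))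

  sameTuple-refl : ∀ (x : Vec (Fin n) m) → T (sameTuple x x)
  sameTuple-refl x = all-intro (allFin m) λ i → sameVertex-refl (lookup x i)

  conflict-intro : ∀ {x y} i j → lookup x i ≡ lookup y j ⊎ Adj G (lookup x i) (lookup y j) → Conflict x y
  conflict-intro {x} {y} i j h = any-intro (∈-allFin i) (any-intro (∈-allFin j) (Equivalence.from T-∨
    ([ (λ eq → inj₁ (subst (λ a → T (sameVertex (lookup x i) a)) eq (sameVertex-refl (lookup x i)))) , inj₂ ]′ h)))

  conflict-elim : ∀ {x y} → Conflict x y → ∃[ i ] ∃[ j ] (lookup x i ≡ lookup y j ⊎ Adj G (lookup x i) (lookup y j))
  conflict-elim h =
    let i , _ , hᵢ = any-elim {xs = allFin m} h
        j , _ , hⱼ = any-elim {xs = allFin m} hᵢ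
    in  i , j , [ inj₁ ∘ sameVertex⇒≡ , inj₂ ]′ (Equivalence.to T-∨ hⱼ)

  Adj-sym : ∀ {a b} → Adj G a b → Adj G b a
  Adj-sym {a} {b} = subst T (symmetric G a b)

  conflict-sym : ∀ {x y} → Conflict x y → Conflict y x
  conflict-sym {x} {y} c = let i , j , h = conflict-elim {x} {y} c in conflict-intro {y} {x} j i ([ inj₁ ∘ sym , inj₂ ∘ Adj-sym ]′ h)

  record Embedding (x : Vec (Fin n) m) : Set where
    field
      injective : ∀ {i j} → lookup x i ≡ lookup x j → i ≡ j
      preserves : ∀ i j → adj H i j ≡ adj G (lookup x i) (lookup x j)

  embeddings-intro : ∀ {x} → Embedding x → x ∈ embeddings
  embeddings-intro {x} emb = filterᵇ-intro (∈-tuples x) (all-intro (allFin m) λ i → all-intro (allFin m) λ j →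
    Equivalence.from T-∧ (edge (adj H i j) (adj G (lookup x i) (lookup x j)) (preserves i j) ,
      unequal (sameVertex i j) (λ eq → subst (λ k → T (sameVertex i k)) (injective (sameVertex⇒≡ eq)) (sameVertex-refl i))))
    where
    open Embedding emb
    edge : ∀ a b → a ≡ b → T (if a then b else not b)
    edge true  _ refl = _
    edge false _ refl = _
    unequal : ∀ a {b} → (T b → T a) → T (a ∨ not b)
    unequal true  _ = _
    unequal false h = T-not-intro h

  embeddings-elim : ∀ {x} → x ∈ embeddings → Embedding x
  embeddings-elim {x} x∈ = record
    { injective = λ {i} {j} eq → sameVertex⇒≡ (unequal (sameVertex i j) (proj₂ (both i j))
        (subst (λ a → T (sameVertex (lookup x i) a)) eq (sameVertex-refl (lookup x i))))
    ; preserves = λ i j → edge (adj H i j) (adj G (lookup x i) (lookup x j)) (proj₁ (both i j))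
    }
    where
    both : ∀ i j → T (if adj H i j then adj G (lookup x i) (lookup x j) else not (adj G (lookup x i) (lookup x j)))
                 × T (sameVertex i j ∨ not (sameVertex (lookup x i) (lookup x j)))
    both i j = Equivalence.to T-∧ (all-elim (all-elim (proj₂ (filterᵇ-elim {xs = tuples n m} x∈)) (∈-allFin i)) (∈-allFin j))
    edge : ∀ a b → T (if a then b else not b) → a ≡ b
    edge true  true  _ = refl
    edge false false _ = refl
    unequal : ∀ a {b} → T (a ∨ not b) → T b → T a
    unequal true  _ _ = _
    unequal false h b = ⊥-elim (T-not-elim h b)

  -- An occurrence may be the image of several embeddings, but for non-empty `H` these are in
  -- conflict, so that no occurrence is counted twice.
  Independent : List (Vec (Fin n) m) → Set
  Independent xs = All (_∈ embeddings) xs × AllPairs (λ x y → ¬ Conflict x y) xs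

  image : Vec (Fin n) m → Subset n
  image x = Vec.tabulate λ a → any (λ i → sameVertex (lookup x i) a) (allFin m)

  ∈-image : ∀ {x a} → a ∈ˢ image x ⇔ (∃[ i ] lookup x i ≡ a)
  ∈-image {x} {a} = mk⇔
    (λ a∈ → let i , _ , h = any-elim {xs = allFin m} (Equivalence.from T-≡ (trans (sym (lookup∘tabulate _ a)) ([]=⇒lookup a∈)))
            in  i , sameVertex⇒≡ h)
    (λ { (i , refl) → lookup⇒[]= a (image x) (trans (lookup∘tabulate _ a)
      (Equivalence.to T-≡ (any-intro (∈-allFin i) (sameVertex-refl (lookup x i))))) })

  to-matching : ∀ {k} xs → Independent xs → k ≤ length xs → InducedMatching H G k
  to-matching {k} xs (emb , apart) k≤ = record
    { member      = image ∘ pick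
    ; occurrences = λ i → let open Embedding (embeddings-elim (All.lookup emb (∈-lookup (inject≤ i k≤)))) in record
      { iso       = lookup (pick i)
      ; injective = injective
      ; image     = λ v → ∈-image {pick i}
      ; preserves = preserves
      }
    ; disjoint    = λ i j i≢j v v∈ v∈′ →
        let a , a≡ = Equivalence.to (∈-image {pick i}) v∈
            b , b≡ = Equivalence.to (∈-image {pick j}) v∈′
        in  pick-apart i j i≢j (conflict-intro {pick i} {pick j} a b (inj₁ (trans a≡ (sym b≡))))
    ; nonadjacent = λ i j i≢j u v u∈ v∈ uv →
        let a , a≡ = Equivalence.to (∈-image {pick i}) u∈
            b , b≡ = Equivalence.to (∈-image {pick j}) v∈
        in  pick-apart i j i≢j (conflict-intro {pick i} {pick j} a b (inj₂ (subst T (sym (cong₂ (adj G) a≡ b≡)) uv)))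
    }
    where
    pick : Fin k → Vec (Fin n) m
    pick i = List.lookup xs (inject≤ i k≤)
    pick-apart : ∀ i j → i ≢ j → ¬ Conflict (pick i) (pick j)
    pick-apart i j i≢j = AllPairs-lookup (λ {x} {y} ¬c → ¬c ∘ conflict-sym {y} {x}) apart _ _
      (i≢j ∘ inject≤-injective k≤ k≤ i j)

  from-matching : ∀ {k} → InducedMatching H G k → ∃[ xs ] (Independent xs × length xs ≡ k)
  from-matching {k} M = List.tabulate tupleOf ,
    (All.tabulate⁺ embedding , AllPairs.tabulate⁺ apart) , length-tabulate tupleOf
    where
    open InducedMatching M

    tupleOf : Fin k → Vec (Fin n) m
    tupleOf i = Vec.tabulate (IsOccurrence.iso (occurrences i))

    at : ∀ i a → lookup (tupleOf i) a ≡ IsOccurrence.iso (occurrences i) a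
    at i a = lookup∘tabulate (IsOccurrence.iso (occurrences i)) a

    at-∈ : ∀ i a → lookup (tupleOf i) a ∈ˢ member i
    at-∈ i a = Equivalence.from (IsOccurrence.image (occurrences i) _) (a , sym (at i a))

    embedding : ∀ i → tupleOf i ∈ embeddings
    embedding i = embeddings-intro record
      { injective = λ {a} {b} eq → IsOccurrence.injective (occurrences i) (trans (sym (at i a)) (trans eq (at i b)))
      ; preserves = λ a b → trans (IsOccurrence.preserves (occurrences i) a b) (sym (cong₂ (adj G) (at i a) (at i b)))
      }

    apart : ∀ {i j} → i ≢ j → ¬ Conflict (tupleOf i) (tupleOf j)
    apart {i} {j} i≢j c with conflict-elim {tupleOf i} {tupleOf j} c
    ... | a , b , inj₁ eq = disjoint i j i≢j _ (at-∈ i a) (subst (_∈ˢ member j) (sym eq) (at-∈ j b))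
    ... | a , b , inj₂ ab = nonadjacent i j i≢j _ _ (at-∈ i a) (at-∈ j b) ab

-- The cyclic order of embeddings and the correctness of the decision

module Geometry {m n : ℕ} (H : Graph (suc m)) (H-connected : ∀ a b → Star (Adj H) a b) (G : Graph n)
  (arc : Family n) (fuzzy : IsFuzzyIntersectionGraph G arc) where

  open Decision H G
  open Matching H G
  open Tuples (suc m)

  Separate : Fin n → Fin n → Set
  Separate u w = u ≢ w × ¬ Adj G u w

  arcs-apart : ∀ {u w} → Separate u w → Apartᴬ (arc u) (arc w)
  arcs-apart {u} {w} (u≢w , ¬uw) meet = ¬uw (proj₁ (fuzzy u w u≢w) meet)

  arcs-meet : ∀ {u w} → Adj G u w → ¬ Disjoint (arc u) (arc w)
  arcs-meet {u} {w} uw dis = proj₂ (fuzzy u w u≢w) dis uw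
    where
    u≢w : u ≢ w
    u≢w refl = subst T (loopless G u) uw

  CyclicVertices : Fin n → Fin n → Fin n → Set
  CyclicVertices u v w = CyclicArcs (arc u) (arc v) (arc w)

  rotateVertices : ∀ {u v w} → CyclicVertices u v w → CyclicVertices v w u
  rotateVertices {u} {v} {w} = rotate {start (arc u)} {start (arc v)} {start (arc w)}

  module _ {s y} (sy : Separate s y) where

    Avoids : Fin n → Set
    Avoids g = Separate g s × Separate g y

    move : ∀ {g g′} → Avoids g → Avoids g′ → Adj G g g′ → CyclicVertices s g y → ¬ ¬ CyclicVertices s g′ y
    move {g} {g′} (gs , gy) (g′s , g′y) gg′ = CyclicArcs-move {arc s} {arc g} {arc y} {arc g′}
      (arcs-apart sy) (arcs-apart gy) (arcs-apart g′s) (arcs-apart g′y) (arcs-meet gg′)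

    move* : ∀ {x} → Embedding x → (∀ i → Avoids (lookup x i)) → ∀ {i j} → Star (Adj H) i j →
            CyclicVertices s (lookup x i) y → ¬ ¬ CyclicVertices s (lookup x j) y
    move* emb av ε          c k = k c
    move* emb av (ab ◅ abs) c k =
      move (av _) (av _) (subst T (Embedding.preserves emb _ _) ab) c λ c′ → move* emb av abs c′ k

  Compatible : Vec (Fin n) (suc m) → Vec (Fin n) (suc m) → Set
  Compatible x y = ¬ Conflict x y

  separate : ∀ x y → Compatible x y → ∀ i j → Separate (lookup x i) (lookup y j)
  separate x y ¬c i j = (λ eq → ¬c (conflict-intro {x} {y} i j (inj₁ eq))) , (λ ad → ¬c (conflict-intro {x} {y} i j (inj₂ ad)))

  rep : Vec (Fin n) (suc m) → Fin n
  rep x = lookup x zero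

  CyclicTuples : (x y z : Vec (Fin n) (suc m)) → Set
  CyclicTuples x y z = CyclicVertices (rep x) (rep y) (rep z)

  -- As `H` is connected, one can walk inside `x` from its first vertex to the place of the
  -- conflict, cross over, and walk inside `x′` to its first vertex. Every vertex on the way is
  -- separate from those of `s` and `y`, so no step changes the cyclic order.
  shift : ∀ {s x x′ y} → Embedding x → Embedding x′ → Conflict x x′ → Compatible s y →
          Compatible x s → Compatible x y → Compatible x′ s → Compatible x′ y →
          CyclicTuples s x y → ¬ ¬ CyclicTuples s x′ y
  shift {s} {x} {x′} {y} emb emb′ c sy xs xy x′s x′y cyc k with conflict-elim {x} {x′} c
  ... | i , j , h =
    move* sep emb av (H-connected zero i) cyc λ cyc₁ →
    cross h cyc₁ λ cyc₂ →
    move* sep emb′ av′ (H-connected j zero) cyc₂ k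
    where
    sep : Separate (rep s) (rep y)
    sep = separate s y sy zero zero
    av : ∀ i → Avoids sep (lookup x i)
    av i = separate x s xs i zero , separate x y xy i zero
    av′ : ∀ i → Avoids sep (lookup x′ i)
    av′ i = separate x′ s x′s i zero , separate x′ y x′y i zero
    cross : lookup x i ≡ lookup x′ j ⊎ Adj G (lookup x i) (lookup x′ j) →
            CyclicVertices (rep s) (lookup x i) (rep y) → ¬ ¬ CyclicVertices (rep s) (lookup x′ j) (rep y)
    cross (inj₁ eq) cyc k = k (subst (λ g → CyclicVertices (rep s) g (rep y)) eq cyc)
    cross (inj₂ ad) cyc   = move sep (av i) (av′ j) ad cyc

  conflict-refl : ∀ x → Conflict x x
  conflict-refl x = conflict-intro {x} {x} zero zero (inj₁ refl)

  module Around (s : Vec (Fin n) (suc m)) where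

    open Orientation sameTuple (conflict G) sameTuple⇒≡ sameTuple-refl conflict-refl (λ {x} {y} → conflict-sym {x} {y}) (compatible s) public

    compatible-elim : ∀ {x} → x ∈ compatible s → Embedding x × Compatible s x
    compatible-elim x∈ = let x∈′ , h = filterᵇ-elim {xs = embeddings} x∈ in embeddings-elim x∈′ , T-not-elim h

    record Triple (x y : Vec (Fin n) (suc m)) : Set where
      field
        embˣ : Embedding x
        embʸ : Embedding y
        xs   : Compatible x s
        sx   : Compatible s x
        ys   : Compatible y s
        sy   : Compatible s y
        xy   : Compatible x y
        yx   : Compatible y x

    open Triple

    triple : ∀ {x y} → (x , y) ∈ U → Triple x y
    triple {x} {y} e∈ =
      let x∈ , y∈ , xy = edge-elim e∈
          embˣ , sx = compatible-elim x∈
          embʸ , sy = compatible-elim y∈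
      in  record
        { embˣ = embˣ
        ; embʸ = embʸ
        ; xs   = λ c → sx (conflict-sym {x} {s} c)
        ; sx   = sx
        ; ys   = λ c → sy (conflict-sym {y} {s} c)
        ; sy   = sy
        ; xy   = xy
        ; yx   = λ c → xy (conflict-sym {y} {x} c)
        }

    shift-cyclic : ∀ {x y x′ y′} → Triple x y → Triple x′ y′ →
                   (x ≡ x′ × Conflict y y′) ⊎ (y ≡ y′ × Conflict x x′) →
                   CyclicTuples s x y → ¬ ¬ CyclicTuples s x′ y′
    shift-cyclic {x} {y} {x′} t t′ (inj₂ (refl , c)) cyc =
      shift {s} {x} {x′} {y} (embˣ t) (embˣ t′) c (sy t) (xs t) (xy t) (xs t′) (xy t′) cyc
    -- Rotated to `x`, `y`, `s`, the triple has the changing embedding in the middle, with `x` and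
    -- `s` as the fixed ones.
    shift-cyclic {x} {y} {y′ = y′} t t′ (inj₁ (refl , c)) cyc k =
      shift {x} {y} {y′} {s} (embʸ t) (embʸ t′) c (xs t) (yx t) (ys t) (yx t′) (ys t′)
        (rotateVertices {rep s} {rep x} {rep y} cyc)
        λ cyc′ → k (rotateVertices {rep y′} {rep s} {rep x} (rotateVertices {rep x} {rep y′} {rep s} cyc′))

    step-cyclic : ∀ {e f} → e ⟶ f → CyclicTuples s (proj₁ e) (proj₂ e) → ¬ ¬ CyclicTuples s (proj₁ f) (proj₂ f)
    step-cyclic {x , y} {x′ , y′} (step e∈ f∈ h) =
      shift-cyclic (triple e∈) (triple f∈) (forced-elim {x} {y} {x′} {y′} h)

    path-cyclic : ∀ {e f} → e ⟶* f → CyclicTuples s (proj₁ e) (proj₂ e) → ¬ ¬ CyclicTuples s (proj₁ f) (proj₂ f)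
    path-cyclic ε        cyc k = k cyc
    path-cyclic (p ◅ ps) cyc k = step-cyclic p cyc λ cyc′ → path-cyclic ps cyc′ k

    -- Classically, `x` and `y` have one of the two cyclic orders around `s`. The path, or its
    -- reversal edge by edge, would carry this order to the opposite one.
    irreversible : ∀ {x y} → (x , y) ∈ U → ¬ ((x , y) ⟶* (y , x))
    irreversible {x} {y} e∈ p =
      let x∈ , y∈ , xy = edge-elim e∈
          _ , sx = compatible-elim x∈
          _ , sy = compatible-elim y∈
      in  CyclicArcs-total {arc (rep s)} {arc (rep x)} {arc (rep y)}
            (arcs-apart (separate s x sx zero zero)) (arcs-apart (separate x y xy zero zero)) (arcs-apart (separate s y sy zero zero))
            (λ sxy → path-cyclic p sxy λ syx → asymmetric {x} {y} sxy syx)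
            (λ syx → path-cyclic (⟶*-swap p) syx λ sxy → asymmetric {x} {y} sxy syx)
      where
      asymmetric : ∀ {x y} → CyclicTuples s x y → ¬ CyclicTuples s y x
      asymmetric {x} {y} = Cyclic-asym {start (arc (rep s))} {start (arc (rep x))} {start (arc (rep y))}

  decide-sound : ∀ k → T (decide k) → InducedMatching H G k
  decide-sound zero    _ = to-matching [] ([] , []) z≤n
  decide-sound (suc k) h =
    let s , s∈ , h′ = any-elim {xs = embeddings} h
        open Around s
        xs , k≤ , in-W , apart = layers-sound irreversible (allFin n) (<ᵇ⇒< (suc k) _ h′)
    in  to-matching (s ∷ xs)
          ( s∈ ∷ All.map (proj₁ ∘ filterᵇ-elim {xs = embeddings}) in-W
          , All.map (proj₂ ∘ compatible-elim) in-W ∷ apart) k≤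

  -- Disjoint members have distinct first vertices. This is why `n` rounds of building layers
  -- suffice, although there may be more embeddings than vertices.
  matching-size : ∀ {k} → InducedMatching H G k → k ≤ n
  matching-size {k} M = injective⇒≤ {f = λ i → IsOccurrence.iso (occurrences i) zero} inj
    where
    open InducedMatching M
    ∈-member : ∀ i → IsOccurrence.iso (occurrences i) zero ∈ˢ member i
    ∈-member i = Equivalence.from (IsOccurrence.image (occurrences i) _) (zero , refl)
    inj : ∀ {i j} → IsOccurrence.iso (occurrences i) zero ≡ IsOccurrence.iso (occurrences j) zero → i ≡ j
    inj {i} {j} eq with i ≟ᶠ j
    ... | yes i≡j = i≡j
    ... | no  i≢j = ⊥-elim (disjoint i j i≢j _ (∈-member i) (subst (_∈ˢ member j) (sym eq) (∈-member j)))

  decide-complete : ∀ k → InducedMatching H G k → T (decide k)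
  decide-complete zero    _ = _
  decide-complete (suc k) M with from-matching M
  -- Any member of the matching would do for the cut; the others are compatible with it.
  ... | s ∷ xs , (s∈ ∷ xs∈ , apart ∷ pairs) , refl =
    any-intro s∈ (<⇒<ᵇ (layers-complete irreversible (allFin n) xs in-W pairs
      (≤-trans (<⇒≤ (matching-size M)) (≤-reflexive (sym (length-tabulate id))))))
    where
    open Around s
    in-W : All (_∈ compatible s) xs
    in-W = All.zipWith (λ (x∈ , sx) → filterᵇ-intro x∈ (T-not-intro sx)) (xs∈ , apart)

theorem3p7 : (m : ℕ) (H : Graph m) → Connected H →
    InducedMatchingInPolynomialTimeOn IsFuzzyCircularArcGraph H
theorem3p7 (suc m) H (_ , H-connected) =
  let P , c , d , runs = PolyTime⇒Program (PolyTime-decide) in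
  P , c , d , λ G k (arc , _ , _ , fuzzy) →
    let t , out , t≤ = runs (encode G k) (Decision.decide H G k) (Main.fn-decide H G k)
    in  Decision.decide H G k , t , out , t≤ ,
        reflects (Decision.decide H G k) 
          (Geometry.decide-sound H H-connected G arc fuzzy k)
          (Geometry.decide-complete H H-connected G arc fuzzy k)
  where
  PolyTime-decide : PolyTime (λ x → Fun.fn (Main.decideF H) (x ∷ []))
  PolyTime-decide = ∘-PolyTime (Fun.poly (Main.decideF H)) (∙-PolyTime id-PolyTime nil-PolyTime)
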